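{- Let $n\ge2$, $1\le p\le n-1$, and let $\pi\in S_n$ be a $p$-resultant permutation such that $\pi^{\mathrm{left}}$ has $i$ left-to-right maxima and $\pi^{\mathrm{right}}$ has $j$ right-to-left minima. Then the number of configurations in $\mathcal{S}(n-1,p)$ that topple to $\pi$ equals $\tfrac12 B_{i,j}$.
   Context: Sites $\{0,1,\dots,n\}$; $\mathcal{S}(n-1,p)$ is the set of configurations of $n$ labeled chips $1,\dots,n$ with one chip on each of sites $1,\dots,n-1$ and an extra chip on site $p$. Toppling: while a site $i$ has at least two chips, pick two chips $\alpha<\beta$ there and move $\alpha$ to $i-1$, $\beta$ to $i+1$; the final configuration is independent of choices, has one chip per site except one empty site, and reading left to right gives the permutation $C$ topples to. $\pi\in S_n$ is $p$-resultant if some $C\in\mathcal{S}(n-1,p)$ topples to it; then $(\pi_1,\dots,\pi_{n-p})$ is a permutation of $[n-p]$. $\pi^{\mathrm{left}}=(\pi_1,\dots,\pi_{n-p})$, $\pi^{\mathrm{right}}=(\pi_{n-p+1},\dots,\pi_n)$. A left-to-right maximum of $w$ is $w_j$ with $w_j=\max(w_1,\dots,w_j)$; a right-to-left minimum is an entry smaller than all entries to its right (last entry included). Poly-Bernoulli numbers of type B: $\sum_{n\ge0}B_{n,k}\frac{x^n}{n!}=\frac{\mathrm{Li}_{ -k}(1-e^{ -x})}{1-e^{ -x}}$, $\mathrm{Li}_s(z)=\sum_{i\ge1}z^i/i^s$. -}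

module Defs where

open import Data.Nat as ℕ using (ℕ; zero; suc; _∸_; _<ᵇ_)
open import Data.Nat.Properties using (_!≢0)
open import Data.Nat.Combinatorics using ()
open import Data.Nat.Base using (_!)
open import Data.Integer as ℤ using (ℤ; +_)
open import Data.Rational as ℚ using (ℚ; _/_)
open import Data.Fin as Fin using (Fin; toℕ)
open import Data.Vec as Vec using (Vec; lookup; _[_]≔_; toList)
open import Data.List as List using (List; []; _∷_; take; drop; filter; length; reverse; upTo)
open import Data.Maybe using (Maybe; just; nothing)
open import Data.Bool using (Bool; true; false; if_then_else_; _∧_)
open import Data.Product using (Σ; ∃; ∃-syntax; _×_; _,_)
open import Relation.Nullary using (does)
open import Relation.Binary.PropositionalEquality using (_≡_)
open import Relation.Binary.Construct.Closure.ReflexiveTransitive using (Star)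
open import Function.Definitions using (Injective)

-- Chips and configurations
--
-- Chips are labelled by Fin n (chip k of Fin n is the chip labelled toℕ k + 1;
-- the order on labels is the order on Fin n).  Sites are integers; a
-- configuration is the vector giving the site of each chip.

Config : ℕ → Set
Config n = Vec ℤ n

chipsAt : ∀ {n} → ℤ → Config n → ℕ
chipsAt s C = length (filter (λ x → x ℤ.≟ s) (toList C))

requiredAt : ℕ → ℕ → ℤ → ℕ
requiredAt n p s =
  if does (+ 1 ℤ.≤? s) ∧ does (s ℤ.≤? + (n ∸ 1))
  then (if does (s ℤ.≟ + p) then 2 else 1)
  else 0

InS : (n p : ℕ) → Config n → Set
InS n p C = ∀ (s : ℤ) → chipsAt s C ≡ requiredAt n p s

data Topple {n : ℕ} : Config n → Config n → Set where
  topple : (C : Config n) (α β : Fin n) → α Fin.< β → lookup C α ≡ lookup C β →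
           Topple C ((C [ α ]≔ (lookup C α ℤ.- + 1)) [ β ]≔ (lookup C β ℤ.+ + 1))

Stable : ∀ {n} → Config n → Set
Stable {n} D = Injective _≡_ _≡_ (lookup D)

Perm : ℕ → Set
Perm n = Vec (Fin n) n

IsPerm : ∀ {n} → Perm n → Set
IsPerm π = Injective _≡_ _≡_ (lookup π)

ReadsAs : ∀ {n} → Config n → Perm n → Set
ReadsAs {n} D π = ∀ (k l : Fin n) → k Fin.< l → lookup D (lookup π k) ℤ.< lookup D (lookup π l)

TopplesTo : ∀ {n} → Config n → Perm n → Set
TopplesTo C π = ∃[ D ] (Star Topple C D × Stable D × ReadsAs D π)

Resultant : (n p : ℕ) → Perm n → Set
Resultant n p π = ∃[ C ] (InS n p C × TopplesTo C π)

word : ∀ {n} → Perm n → List ℕ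
word π = List.map (λ k → suc (toℕ k)) (toList π)

πleft : ∀ {n} → ℕ → Perm n → List ℕ
πleft {n} p π = take (n ∸ p) (word π)

πright : ∀ {n} → ℕ → Perm n → List ℕ
πright {n} p π = drop (n ∸ p) (word π)

lrMaxFrom : Maybe ℕ → List ℕ → ℕ
lrMaxFrom m [] = 0
lrMaxFrom nothing (x ∷ xs) = suc (lrMaxFrom (just x) xs)
lrMaxFrom (just m) (x ∷ xs) = if m <ᵇ x then suc (lrMaxFrom (just x) xs) else lrMaxFrom (just m) xs

lrMaxima : List ℕ → ℕ
lrMaxima = lrMaxFrom nothing

rlMinFrom : Maybe ℕ → List ℕ → ℕ
rlMinFrom m [] = 0
rlMinFrom nothing (x ∷ xs) = suc (rlMinFrom (just x) xs)
rlMinFrom (just m) (x ∷ xs) = if x <ᵇ m then suc (rlMinFrom (just x) xs) else rlMinFrom (just m) xs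

rlMinima : List ℕ → ℕ
rlMinima w = rlMinFrom nothing (reverse w)

PS : Set
PS = ℕ → ℚ

sumTo : ℕ → (ℕ → ℚ) → ℚ
sumTo zero f = f 0
sumTo (suc n) f = sumTo n f ℚ.+ f (suc n)

_⊛_ : PS → PS → PS
(f ⊛ g) n = sumTo n (λ k → f k ℚ.* g (n ∸ k))

oneS : PS
oneS zero = ℚ.1ℚ
oneS (suc _) = ℚ.0ℚ

_^S_ : PS → ℕ → PS
f ^S zero = oneS
f ^S suc m = f ⊛ (f ^S m)

expNeg : PS
expNeg k = (ℤ.-_ (+ 1) ℤ.^ k) / (k !)
  where instance _ = k !≢0

zS : PS
zS k = oneS k ℚ.- expNeg k

-- Li_{-k}(z)/z = Σ_{i≥1} i^k z^{i-1}.  Since z(x) has zero constant term,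
-- z(x)^{i-1} contributes to x^n only when i-1 ≤ n, so
-- [x^n] Li_{-k}(1-e^{-x})/(1-e^{-x}) = Σ_{m=0}^{n} (m+1)^k [x^n] z(x)^m.
-- B_{n,k} = n! · [x^n] Li_{-k}(1-e^{-x})/(1-e^{-x}).
polyBernoulliB : ℕ → ℕ → ℚ
polyBernoulliB n k =
  (+ (n !) / 1) ℚ.* sumTo n (λ m → (+ (suc m ℕ.^ k) / 1) ℚ.* (zS ^S m) n)

{-# OPTIONS --safe #-}

-- The chips never have a choice within a site, and every order of topplings has the same set of
-- topplings: a p × (n-p) grid of comparators.  Hence C topples to π exactly when the word of C (chips
-- listed by site) is turned into π by p sweeps, each of which carries a chip to the right through n-p
-- others, always leaving the smaller one behind.  A sweep is undone by choosing a subset of the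
-- left-to-right maxima of π^left, and a right entry that is not a right-to-left minimum forces the empty
-- choice.  Counting by the number of maxima that survive gives the recurrence
--   B(i,j+1) = B(i,j) + Σ_{k<i} C(i,k) B(k+1,j),
-- which on the analytic side is the identity Li_{-k-1}(z)/z = d/dz Li_{-k}(z).  The two chips on site p
-- enter the first comparator in either order, whence the factor ½.
module Submission where

open import Defs
open import Data.Nat using (ℕ; _≤_; _∸_)
open import Data.List using (List; length)
open import Data.List.Membership.Propositional using (_∈_)
open import Data.List.Relation.Unary.Unique.Propositional using (Unique)
open import Data.Integer using (+_)
open import Data.Rational using (ℚ; _/_; ½; _*_)
open import Data.Product using (∃-syntax; _×_)
open import Function.Bundles using (_⇔_; mk⇔)
open import Relation.Binary.PropositionalEquality using (_≡_; _≢_; refl; sym; trans; cong; cong₂; subst; subst₂; setoid; module ≡-Reasoning)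

open import Data.Nat as ℕ using (zero; suc; _!; _<_; z≤n; s≤s; s<s; z<s; _⊓_)
import Data.Nat.Properties as ℕ
import Data.Nat.Solver as ℕSolver
open import Data.Integer as ℤ using (ℤ; -[1+_])
import Data.Integer.Properties as ℤ
open import Data.Rational as ℚ using (toℚᵘ)
import Data.Rational.Properties as ℚ
import Data.Rational.Solver as ℚSolver
open import Data.Rational.Unnormalised as ℚᵘ using (mkℚᵘ)
import Data.Rational.Unnormalised.Properties as ℚᵘ
open import Data.Bool using (true; false; if_then_else_)
open import Data.Maybe using (just; nothing)
import Data.Maybe.Relation.Unary.All as MAll
import Data.Maybe.Relation.Unary.Any as MAny
open import Data.Empty using (⊥-elim)
open import Data.Fin as Fin using (Fin; toℕ)
import Data.Fin.Properties as Fin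
open import Data.List using ([]; _∷_; _++_; _∷ʳ_; map; concatMap; reverse; filter; allFin; take; drop; tabulate)
import Data.List.Properties as List
open import Data.List.Membership.Propositional using (find; lose)
open import Data.List.Membership.Propositional.Properties
  using (∈-concatMap⁺; ∈-concatMap⁻; ∈-map⁺; ∈-map⁻; ∈-∃++; ∈-allFin)
open import Data.List.Relation.Unary.All as All using (All; []; _∷_)
import Data.List.Relation.Unary.All.Properties as All
open import Data.List.Relation.Unary.Any as Any using (Any; here; there)
import Data.List.Relation.Unary.Any.Properties as Any
open import Data.List.Relation.Unary.AllPairs using (AllPairs; []; _∷_)
import Data.List.Relation.Unary.AllPairs.Properties as AllPairs
import Data.List.Relation.Unary.Unique.Propositional.Properties as Unique
open import Data.List.Relation.Binary.Permutation.Propositional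
  using (_↭_; prep; swap; ↭-trans; ↭-sym; ↭-refl; ↭-reflexive; ↭⇒↭ₛ)
import Data.List.Relation.Binary.Permutation.Propositional.Properties as ↭
open import Data.List.Relation.Binary.Permutation.Propositional.Properties
  using (All-resp-↭; Any-resp-↭; ∈-resp-↭; ↭-length; shift; ++⁺ʳ; ↭-reverse; drop-∷; ↭-empty-inv; ↭-map-inv)
import Data.List.Relation.Binary.Permutation.Setoid.Properties as Permutationₛ
open import Data.Vec as Vec using (Vec; []; _∷_; lookup; toList; _[_]≔_)
import Data.Vec.Properties as Vec
open import Data.Product using (_,_; proj₁; proj₂; map₁; map₂)
open import Data.Sum using (_⊎_; inj₁; inj₂)
open import Function using (_∘_; id)
open import Relation.Nullary using (¬_; Dec; does; yes; no; _×-dec_)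
open import Relation.Nullary.Decidable using (dec-true; dec-false)
open import Relation.Binary.Construct.Closure.ReflexiveTransitive as Star using (Star; ε; _◅_; _◅◅_)
open import Relation.Binary.Definitions using (tri<; tri≈; tri>)

-- A comparator with output `o` and larger chip `m` has two possible inputs. If they came in order,
-- `o` was the chip carried in, so it must exceed every output to its left; hence the choices sit
-- exactly at the left-to-right maxima. The undone row then holds `m` or `o` in that place, so its
-- maxima have to be counted over two different bounds. Counted over `m` they obey Pascal's rule,
-- counted over `o` the recursion of `bernoulliStep`; the second count draws on the first.
--
-- Every left entry must lie below every right entry still to be put back. A right entry that is not
-- a right-to-left minimum may therefore not enter the left row, which is why its sweep has only the
-- trivial undoing.
--
-- For j = 1 the two summands of the recurrence are equal and each is the number of configurations;
-- so twice the count fits the recurrence that starts at B(i,0) = 1.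
--
-- The sweeps are one order of toppling among many, so they determine the outcome only once
-- confluence is known. It follows from bounds on the number of chips on sites up to s, which no
-- toppling violates.

module PolyBernoulli where
  open import Data.Rational using (_+_; -_; _-_; 0ℚ; 1ℚ)
  open ℚSolver.+-*-Solver using (solve; _:=_; _:+_; _:*_; _:-_; :-_; con)

  ι : ℕ → ℚ
  ι n = + n / 1

  ι-via : ∀ {n q} → mkℚᵘ (+ n) 0 ℚᵘ.≃ toℚᵘ q → ι n ≡ q
  ι-via {n} eq = ℚ.toℚᵘ-injective (ℚᵘ.≃-trans (ℚ.toℚᵘ-fromℚᵘ (mkℚᵘ (+ n) 0)) eq)

  ι-+ : ∀ m n → ι (m ℕ.+ n) ≡ ι m + ι n
  ι-+ m n = ι-via {m ℕ.+ n} (ℚᵘ.≃-trans (ℚᵘ.*≡* (cong (ℤ._* + 1) (cong₂ ℤ._+_ (sym (ℤ.*-identityʳ (+ m))) (sym (ℤ.*-identityʳ (+ n))))))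
    (ℚᵘ.≃-sym (ℚᵘ.≃-trans (ℚ.toℚᵘ-homo-+ (ι m) (ι n))
      (ℚᵘ.+-cong (ℚ.toℚᵘ-fromℚᵘ (mkℚᵘ (+ m) 0)) (ℚ.toℚᵘ-fromℚᵘ (mkℚᵘ (+ n) 0))))))

  ι-* : ∀ m n → ι (m ℕ.* n) ≡ ι m * ι n
  ι-* m n = ι-via {m ℕ.* n} (ℚᵘ.≃-trans (ℚᵘ.*≡* (cong (ℤ._* + 1) (ℤ.pos-* m n)))
    (ℚᵘ.≃-sym (ℚᵘ.≃-trans (ℚ.toℚᵘ-homo-* (ι m) (ι n))
      (ℚᵘ.*-cong (ℚ.toℚᵘ-fromℚᵘ (mkℚᵘ (+ m) 0)) (ℚ.toℚᵘ-fromℚᵘ (mkℚᵘ (+ n) 0))))))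

  ι-suc : ∀ n → ι (suc n) ≡ 1ℚ + ι n
  ι-suc = ι-+ 1

  sumTo-cong≤ : ∀ n {f g : ℕ → ℚ} → (∀ k → k ≤ n → f k ≡ g k) → sumTo n f ≡ sumTo n g
  sumTo-cong≤ zero eq = eq 0 z≤n
  sumTo-cong≤ (suc n) eq = cong₂ _+_ (sumTo-cong≤ n (λ k k≤n → eq k (ℕ.m≤n⇒m≤1+n k≤n))) (eq (suc n) ℕ.≤-refl)

  sumTo-cong : ∀ n {f g : ℕ → ℚ} → (∀ k → f k ≡ g k) → sumTo n f ≡ sumTo n g
  sumTo-cong n eq = sumTo-cong≤ n (λ k _ → eq k)

  sumTo-+ : ∀ n (f g : ℕ → ℚ) → sumTo n (λ k → f k + g k) ≡ sumTo n f + sumTo n g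
  sumTo-+ zero f g = refl
  sumTo-+ (suc n) f g = trans (cong (_+ (f (suc n) + g (suc n))) (sumTo-+ n f g))
    (solve 4 (λ a b c d → (a :+ b) :+ (c :+ d) := (a :+ c) :+ (b :+ d)) refl (sumTo n f) (sumTo n g) (f (suc n)) (g (suc n)))

  sumTo-* : ∀ n c (f : ℕ → ℚ) → sumTo n (λ k → c * f k) ≡ c * sumTo n f
  sumTo-* zero c f = refl
  sumTo-* (suc n) c f = trans (cong (_+ c * f (suc n)) (sumTo-* n c f)) (sym (ℚ.*-distribˡ-+ c (sumTo n f) (f (suc n))))

  sumTo-0 : ∀ n {f : ℕ → ℚ} → (∀ k → k ≤ n → f k ≡ 0ℚ) → sumTo n f ≡ 0ℚ
  sumTo-0 zero eq = eq 0 z≤n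
  sumTo-0 (suc n) eq = cong₂ _+_ (sumTo-0 n (λ k k≤n → eq k (ℕ.m≤n⇒m≤1+n k≤n))) (eq (suc n) ℕ.≤-refl)

  sumTo-head : ∀ n (f : ℕ → ℚ) → sumTo (suc n) f ≡ f 0 + sumTo n (f ∘ suc)
  sumTo-head zero f = refl
  sumTo-head (suc n) f = trans (cong (_+ f (suc (suc n))) (sumTo-head n f)) (ℚ.+-assoc (f 0) (sumTo n (f ∘ suc)) (f (suc (suc n))))

  deriv : PS → PS
  deriv f n = ι (suc n) * f (suc n)

  ⊛-congˡ : ∀ n {f g : PS} h → (∀ k → f k ≡ g k) → (f ⊛ h) n ≡ (g ⊛ h) n
  ⊛-congˡ n h eq = sumTo-cong n (λ k → cong (_* h (n ∸ k)) (eq k))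

  ⊛-congʳ : ∀ n f {g h : PS} → (∀ k → g k ≡ h k) → (f ⊛ g) n ≡ (f ⊛ h) n
  ⊛-congʳ n f eq = sumTo-cong n (λ k → cong (f k *_) (eq (n ∸ k)))

  -- In the term of index `k` the factor n + 1 splits as k + (n + 1 - k), one share for each factor
  -- of the product.
  deriv-⊛ : ∀ (f g : PS) n → deriv (f ⊛ g) n ≡ (deriv f ⊛ g) n + (f ⊛ deriv g) n
  deriv-⊛ f g n = begin
    ι (suc n) * sumTo (suc n) (λ k → f k * g (suc n ∸ k))
      ≡⟨ sumTo-* (suc n) (ι (suc n)) (λ k → f k * g (suc n ∸ k)) ⟨
    sumTo (suc n) (λ k → ι (suc n) * (f k * g (suc n ∸ k)))
      ≡⟨ sumTo-cong≤ (suc n) split ⟩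
    sumTo (suc n) (λ k → l k + r k)
      ≡⟨ sumTo-+ (suc n) l r ⟩
    sumTo (suc n) l + sumTo (suc n) r
      ≡⟨ cong₂ _+_ left right ⟩
    (deriv f ⊛ g) n + (f ⊛ deriv g) n ∎
    where
    open ≡-Reasoning
    l r : ℕ → ℚ
    l k = ι k * f k * g (suc n ∸ k)
    r k = f k * (ι (suc n ∸ k) * g (suc n ∸ k))
    split : ∀ k → k ≤ suc n → ι (suc n) * (f k * g (suc n ∸ k)) ≡ l k + r k
    split k k≤ = trans (cong (λ x → x * (f k * g (suc n ∸ k)))
        (trans (cong ι (sym (ℕ.m+[n∸m]≡n k≤))) (ι-+ k (suc n ∸ k))))
      (solve 4 (λ a b c d → (a :+ b) :* (c :* d) := a :* c :* d :+ c :* (b :* d)) refl (ι k) (ι (suc n ∸ k)) (f k) (g (suc n ∸ k)))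
    left : sumTo (suc n) l ≡ (deriv f ⊛ g) n
    left = trans (sumTo-head n l) (trans (cong (_+ sumTo n (l ∘ suc)) (trans (cong (_* g (suc n)) (ℚ.*-zeroˡ (f 0))) (ℚ.*-zeroˡ (g (suc n))))) (ℚ.+-identityˡ _))
    right : sumTo (suc n) r ≡ (f ⊛ deriv g) n
    right = trans (cong₂ _+_ (sumTo-cong≤ n (λ k k≤n → cong (λ j → f k * (ι j * g j)) (ℕ.+-∸-assoc 1 k≤n)))
        (trans (cong (λ j → f (suc n) * (ι j * g j)) (ℕ.n∸n≡0 n)) (trans (cong (f (suc n) *_) (ℚ.*-zeroˡ (g 0))) (ℚ.*-zeroʳ (f (suc n))))))
      (ℚ.+-identityʳ _)

  oneS-⊛ : ∀ f n → (oneS ⊛ f) n ≡ f n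
  oneS-⊛ f zero = ℚ.*-identityˡ (f 0)
  oneS-⊛ f (suc n) = trans (sumTo-head n (λ k → oneS k * f (suc n ∸ k)))
    (trans (cong₂ _+_ (ℚ.*-identityˡ (f (suc n))) (sumTo-0 n (λ k _ → ℚ.*-zeroˡ (f (n ∸ k))))) (ℚ.+-identityʳ _))

  toℚᵘ-/ : ∀ i d .{{_ : ℕ.NonZero d}} → toℚᵘ (i / d) ℚᵘ.≃ i ℚᵘ./ d
  toℚᵘ-/ i (suc d) = ℚ.toℚᵘ-fromℚᵘ (mkℚᵘ i d)

  neg-cancel-/ : ∀ m i d .{{_ : ℕ.NonZero d}} .{{_ : ℕ.NonZero (suc m ℕ.* d)}} →
    ι (suc m) * ((ℤ.- i) / (suc m ℕ.* d)) ≡ - (i / d)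
  neg-cancel-/ m i (suc d) = ℚ.toℚᵘ-injective (begin
    toℚᵘ (ι (suc m) * ((ℤ.- i) / (suc m ℕ.* suc d))) ≈⟨ ℚ.toℚᵘ-homo-* (ι (suc m)) _ ⟩
    toℚᵘ (ι (suc m)) ℚᵘ.* toℚᵘ ((ℤ.- i) / (suc m ℕ.* suc d))
      ≈⟨ ℚᵘ.*-cong (ℚ.toℚᵘ-fromℚᵘ (mkℚᵘ (+ suc m) 0)) (toℚᵘ-/ (ℤ.- i) (suc m ℕ.* suc d)) ⟩
    mkℚᵘ (+ suc m) 0 ℚᵘ.* ((ℤ.- i) ℚᵘ./ (suc m ℕ.* suc d)) ≈⟨ ℚᵘ.*≡* cross ⟩
    ℚᵘ.- (i ℚᵘ./ suc d) ≈⟨ ℚᵘ.-‿cong (toℚᵘ-/ i (suc d)) ⟨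
    ℚᵘ.- toℚᵘ (i / suc d) ≈⟨ ℚ.toℚᵘ-homo‿- (i / suc d) ⟨
    toℚᵘ (- (i / suc d)) ∎)
    where
    open ℚᵘ.≃-Reasoning
    cross : + suc m ℤ.* (ℤ.- i) ℤ.* + suc d ≡ (ℤ.- i) ℤ.* + (1 ℕ.* (suc m ℕ.* suc d))
    cross = trans (cong (ℤ._* + suc d) (ℤ.*-comm (+ suc m) (ℤ.- i)))
      (trans (ℤ.*-assoc (ℤ.- i) (+ suc m) (+ suc d))
        (cong (ℤ._*_ (ℤ.- i)) (trans (sym (ℤ.pos-* (suc m) (suc d))) (cong +_ (sym (ℕ.*-identityˡ (suc m ℕ.* suc d)))))))

  expNeg-suc : ∀ n → ι (suc n) * expNeg (suc n) ≡ - expNeg n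
  expNeg-suc n = trans (cong (λ i → ι (suc n) * (_/_ i (suc n !) {{suc n ℕ.!≢0}})) (ℤ.-1*i≡-i e))
    (neg-cancel-/ n e (n !) {{n ℕ.!≢0}} {{suc n ℕ.!≢0}})
    where e = (ℤ.- + 1) ℤ.^ n

  deriv-z : ∀ n → deriv zS n ≡ oneS n - zS n
  deriv-z n = begin
    ι (suc n) * (0ℚ - expNeg (suc n)) ≡⟨ solve 2 (λ a b → a :* (con 0ℚ :- b) := :- (a :* b)) refl (ι (suc n)) (expNeg (suc n)) ⟩
    - (ι (suc n) * expNeg (suc n)) ≡⟨ cong -_ (expNeg-suc n) ⟩
    - (- expNeg n) ≡⟨ solve 2 (λ a b → :- (:- b) := a :- (a :- b)) refl (oneS n) (expNeg n) ⟩
    oneS n - zS n ∎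
    where open ≡-Reasoning

  deriv-z^ : ∀ m n → deriv (zS ^S suc m) n ≡ ι (suc m) * ((zS ^S m) n - (zS ^S suc m) n)
  deriv-z^ m n = begin
    deriv (zS ⊛ z^m) n ≡⟨ deriv-⊛ zS z^m n ⟩
    (deriv zS ⊛ z^m) n + (zS ⊛ deriv z^m) n ≡⟨ cong₂ _+_ first (rest m) ⟩
    (z^m n - z^sm n) + ι m * (z^m n - z^sm n) ≡⟨ solve 2 (λ a b → b :+ a :* b := (con 1ℚ :+ a) :* b) refl (ι m) (z^m n - z^sm n) ⟩
    (1ℚ + ι m) * (z^m n - z^sm n) ≡⟨ cong (_* (z^m n - z^sm n)) (ι-suc m) ⟨
    ι (suc m) * (z^m n - z^sm n) ∎
    where
    open ≡-Reasoning
    z^m z^sm : PS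
    z^m = zS ^S m
    z^sm = zS ^S suc m
    ⊛-minus : ∀ (f g h : PS) → sumTo n (λ k → (f k - g k) * h (n ∸ k)) ≡ (f ⊛ h) n - (g ⊛ h) n
    ⊛-minus f g h = trans (sumTo-cong n (λ k → solve 3 (λ a b c → (a :- b) :* c := a :* c :+ con (- 1ℚ) :* (b :* c)) refl (f k) (g k) (h (n ∸ k))))
      (trans (sumTo-+ n (λ k → f k * h (n ∸ k)) (λ k → - 1ℚ * (g k * h (n ∸ k))))
        (trans (cong (λ x → (f ⊛ h) n + x) (sumTo-* n (- 1ℚ) (λ k → g k * h (n ∸ k))))
          (solve 2 (λ a b → a :+ con (- 1ℚ) :* b := a :- b) refl ((f ⊛ h) n) ((g ⊛ h) n))))
    first : (deriv zS ⊛ z^m) n ≡ z^m n - z^sm n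
    first = trans (⊛-congˡ n z^m deriv-z) (trans (⊛-minus oneS zS z^m) (cong (λ x → x - z^sm n) (oneS-⊛ z^m n)))
    z^0 : ℚ
    z^0 = (zS ^S 0) n
    rest : ∀ m → (zS ⊛ deriv (zS ^S m)) n ≡ ι m * ((zS ^S m) n - (zS ^S suc m) n)
    rest zero = trans (sumTo-0 n (λ k _ → trans (cong (zS k *_) (ℚ.*-zeroʳ (ι (suc (n ∸ k))))) (ℚ.*-zeroʳ (zS k))))
      (sym (ℚ.*-zeroˡ (z^0 - (zS ^S 1) n)))
    rest (suc m) = begin
      (zS ⊛ deriv (zS ^S suc m)) n ≡⟨ ⊛-congʳ n zS (deriv-z^ m) ⟩
      sumTo n (λ k → zS k * (ι (suc m) * (a (n ∸ k) - b (n ∸ k))))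
        ≡⟨ sumTo-cong n (λ k → solve 4 (λ c x a b → x :* (c :* (a :- b)) := c :* (x :* a :+ con (- 1ℚ) :* (x :* b))) refl (ι (suc m)) (zS k) (a (n ∸ k)) (b (n ∸ k))) ⟩
      sumTo n (λ k → ι (suc m) * (zS k * a (n ∸ k) + - 1ℚ * (zS k * b (n ∸ k))))
        ≡⟨ sumTo-* n (ι (suc m)) _ ⟩
      ι (suc m) * sumTo n (λ k → zS k * a (n ∸ k) + - 1ℚ * (zS k * b (n ∸ k)))
        ≡⟨ cong (ι (suc m) *_) (sumTo-+ n _ _) ⟩
      ι (suc m) * ((zS ⊛ a) n + sumTo n (λ k → - 1ℚ * (zS k * b (n ∸ k))))
        ≡⟨ cong (λ x → ι (suc m) * ((zS ⊛ a) n + x)) (sumTo-* n (- 1ℚ) _) ⟩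
      ι (suc m) * ((zS ⊛ a) n + - 1ℚ * (zS ⊛ b) n)
        ≡⟨ cong (ι (suc m) *_) (solve 2 (λ a b → a :+ con (- 1ℚ) :* b := a :- b) refl ((zS ⊛ a) n) ((zS ⊛ b) n)) ⟩
      ι (suc m) * ((zS ⊛ a) n - (zS ⊛ b) n) ∎
      where
      a b : PS
      a = zS ^S m
      b = zS ^S suc m

  -- `zS` has no constant term. This is what makes cutting a series in z off at m = n harmless.
  z^-vanish : ∀ m n → n < m → (zS ^S m) n ≡ 0ℚ
  z^-vanish (suc m) n (s≤s n≤m) = sumTo-0 n term
    where
    term : ∀ k → k ≤ n → zS k * (zS ^S m) (n ∸ k) ≡ 0ℚ
    term zero _ = ℚ.*-zeroˡ ((zS ^S m) n)
    term (suc k) k<n = trans (cong (zS (suc k) *_) (z^-vanish m (n ∸ suc k) (ℕ.<-≤-trans (ℕ.∸-monoʳ-< z<s k<n) n≤m))) (ℚ.*-zeroʳ (zS (suc k)))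

  -- egfCoeff c n = n! [xⁿ] Σ_m c(m) z^m with z = 1 - e^{-x}; on the coefficients c, differentiation in x acts as ∂,
  -- multiplication by e^x = 1/(1-z) as psum, and G ↦ d/dz (z G) as θ.
  egfCoeff : (ℕ → ℚ) → ℕ → ℚ
  egfCoeff c n = ι (n !) * sumTo n (λ m → c m * (zS ^S m) n)

  egfCoeff-cong : ∀ n {c d : ℕ → ℚ} → (∀ m → c m ≡ d m) → egfCoeff c n ≡ egfCoeff d n
  egfCoeff-cong n eq = cong (ι (n !) *_) (sumTo-cong n (λ m → cong (_* (zS ^S m) n) (eq m)))

  egfCoeff-+ : ∀ n (c d : ℕ → ℚ) → egfCoeff (λ m → c m + d m) n ≡ egfCoeff c n + egfCoeff d n
  egfCoeff-+ n c d = trans (cong (ι (n !) *_) (trans (sumTo-cong n (λ m → ℚ.*-distribʳ-+ ((zS ^S m) n) (c m) (d m))) (sumTo-+ n _ _)))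
    (ℚ.*-distribˡ-+ (ι (n !)) _ _)

  ∂ : (ℕ → ℚ) → ℕ → ℚ
  ∂ c m = ι (suc m) * c (suc m) - ι m * c m

  -- Termwise differentiation: (z^m)' = m (z^{m-1} - z^m), and collecting z^m gives the coefficient
  -- (m+1) c(m+1) - m c(m).
  egfCoeff-suc : ∀ c n → egfCoeff c (suc n) ≡ egfCoeff (∂ c) n
  egfCoeff-suc c n = begin
    ι (suc n !) * sumTo (suc n) (λ m → c m * a (suc n) m)
      ≡⟨ cong₂ _*_ (trans (ι-* (suc n) (n !)) (ℚ.*-comm (ι (suc n)) (ι (n !)))) head ⟩
    ι (n !) * ι (suc n) * sumTo n (λ m → c (suc m) * a (suc n) (suc m))
      ≡⟨ ℚ.*-assoc (ι (n !)) (ι (suc n)) _ ⟩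
    ι (n !) * (ι (suc n) * sumTo n (λ m → c (suc m) * a (suc n) (suc m)))
      ≡⟨ cong (ι (n !) *_) (trans (sym (sumTo-* n (ι (suc n)) _)) (trans (sumTo-cong n term) (trans (sumTo-+ n s t) (trans (cong (λ x → sumTo n s + x) reindex) (sym (trans (sumTo-cong n split) (sumTo-+ n s u))))))) ⟩
    ι (n !) * sumTo n (λ m → ∂ c m * a n m) ∎
    where
    open ≡-Reasoning
    a : ℕ → ℕ → ℚ
    a n m = (zS ^S m) n
    head : sumTo (suc n) (λ m → c m * a (suc n) m) ≡ sumTo n (λ m → c (suc m) * a (suc n) (suc m))
    head = trans (sumTo-head n _) (trans (cong (_+ sumTo n (λ m → c (suc m) * a (suc n) (suc m))) (ℚ.*-zeroʳ (c 0))) (ℚ.+-identityˡ _))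
    s t u w : ℕ → ℚ
    s m = ι (suc m) * c (suc m) * a n m
    w m = - 1ℚ * (ι m * c m * a n m)
    t m = w (suc m)
    u m = w m
    term : ∀ m → ι (suc n) * (c (suc m) * a (suc n) (suc m)) ≡ s m + t m
    term m = trans (solve 3 (λ x y z → x :* (y :* z) := y :* (x :* z)) refl (ι (suc n)) (c (suc m)) (a (suc n) (suc m)))
      (trans (cong (c (suc m) *_) (deriv-z^ m n))
        (solve 4 (λ x y p q → y :* (x :* (p :- q)) := x :* y :* p :+ con (- 1ℚ) :* (x :* y :* q)) refl (ι (suc m)) (c (suc m)) (a n m) (a n (suc m))))
    split : ∀ m → ∂ c m * a n m ≡ s m + u m
    split m = solve 3 (λ x y z → (x :- y) :* z := x :* z :+ con (- 1ℚ) :* (y :* z)) refl (ι (suc m) * c (suc m)) (ι m * c m) (a n m)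
    w0 : w 0 ≡ 0ℚ
    w0 = trans (cong (λ x → - 1ℚ * (x * a n 0)) (ℚ.*-zeroˡ (c 0))) (trans (cong (- 1ℚ *_) (ℚ.*-zeroˡ (a n 0))) (ℚ.*-zeroʳ (- 1ℚ)))
    -- The shifted sum overshoots by the power z^{n+1}, which has no coefficient at x^n.
    wlast : w (suc n) ≡ 0ℚ
    wlast = trans (cong (λ x → - 1ℚ * (ι (suc n) * c (suc n) * x)) (z^-vanish (suc n) n ℕ.≤-refl))
      (trans (cong (- 1ℚ *_) (ℚ.*-zeroʳ (ι (suc n) * c (suc n)))) (ℚ.*-zeroʳ (- 1ℚ)))
    reindex : sumTo n t ≡ sumTo n u
    reindex = begin
      sumTo n (w ∘ suc) ≡⟨ trans (cong (_+ sumTo n (w ∘ suc)) w0) (ℚ.+-identityˡ _) ⟨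
      w 0 + sumTo n (w ∘ suc) ≡⟨ sumTo-head n w ⟨
      sumTo n w + w (suc n) ≡⟨ trans (cong (λ x → sumTo n w + x) wlast) (ℚ.+-identityʳ _) ⟩
      sumTo n w ∎

  -- binomialSum n g = Σ_k C(n,k) g(k) and bernoulliStep n g = g(n) + Σ_{k<n} C(n,k) g(k+1)
  binomialSum bernoulliStep : ℕ → (ℕ → ℕ) → ℕ
  binomialSum zero g = g 0
  binomialSum (suc n) g = binomialSum n (g ∘ suc) ℕ.+ binomialSum n g
  bernoulliStep zero g = g 0
  bernoulliStep (suc n) g = binomialSum n (g ∘ suc) ℕ.+ bernoulliStep n (g ∘ suc)

  -- B(i,j) with j first: the recursion is on j and treats i ↦ B(i,j) as a single function.
  polyBernoulliℕ : ℕ → ℕ → ℕ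
  polyBernoulliℕ zero i = 1
  polyBernoulliℕ (suc j) i = bernoulliStep i (polyBernoulliℕ j)

  psum : (ℕ → ℚ) → ℕ → ℚ
  psum c m = sumTo m c

  θ : (ℕ → ℚ) → ℕ → ℚ
  θ c m = ι (suc m) * c m

  -- Telescoping: `∂ c` is the difference sequence of m ↦ m c(m), which starts at 0.
  psum-∂ : ∀ c m → psum (∂ c) m ≡ ι (suc m) * c (suc m)
  psum-∂ c zero = trans (cong (λ x → ι 1 * c 1 - x) (ℚ.*-zeroˡ (c 0))) (ℚ.+-identityʳ (ι 1 * c 1))
  psum-∂ c (suc m) = trans (cong (_+ ∂ c (suc m)) (psum-∂ c m))
    (solve 2 (λ x y → x :+ (y :- x) := y) refl (ι (suc m) * c (suc m)) (ι (suc (suc m)) * c (suc (suc m))))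

  -- The coefficient form of (e^x G)' = e^x G' + e^x G, matching the Pascal clause of `binomialSum`.
  ∂-psum : ∀ c m → psum (∂ c) m + psum c m ≡ ∂ (psum c) m
  ∂-psum c m = begin
    psum (∂ c) m + psum c m ≡⟨ cong (_+ psum c m) (trans (psum-∂ c m) (cong (_* c (suc m)) (ι-suc m))) ⟩
    (1ℚ + ι m) * c (suc m) + psum c m
      ≡⟨ solve 3 (λ i c s → (con 1ℚ :+ i) :* c :+ s := (con 1ℚ :+ i) :* (s :+ c) :- i :* s) refl (ι m) (c (suc m)) (psum c m) ⟩
    (1ℚ + ι m) * (psum c m + c (suc m)) - ι m * psum c m
      ≡⟨ cong (λ x → x * (psum c m + c (suc m)) - ι m * psum c m) (ι-suc m) ⟨
    ∂ (psum c) m ∎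
    where open ≡-Reasoning

  -- As d/dx is (1-z) d/dz, the derivative of d/dz (zG) is e^x G' plus the same operator applied to
  -- G'; this matches the second clause of `bernoulliStep`.
  ∂-θ : ∀ c m → psum (∂ c) m + θ (∂ c) m ≡ ∂ (θ c) m
  ∂-θ c m = begin
    psum (∂ c) m + θ (∂ c) m ≡⟨ cong (_+ θ (∂ c) m) (psum-∂ c m) ⟩
    ι (suc m) * c (suc m) + ι (suc m) * (ι (suc m) * c (suc m) - ι m * c m)
      ≡⟨ solve 4 (λ i j c d → j :* d :+ j :* (j :* d :- i :* c) := j :* ((con 1ℚ :+ j) :* d) :- i :* (j :* c)) refl (ι m) (ι (suc m)) (c m) (c (suc m)) ⟩
    ι (suc m) * ((1ℚ + ι (suc m)) * c (suc m)) - ι m * (ι (suc m) * c m)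
      ≡⟨ cong (λ x → ι (suc m) * (x * c (suc m)) - ι m * (ι (suc m) * c m)) (ι-suc (suc m)) ⟨
    ∂ (θ c) m ∎
    where open ≡-Reasoning

  -- `g` and `c` vary in the induction: shifting the sequence `g` differentiates its generating
  -- function, which is `∂` on `c`.
  binomialSum-egfCoeff : ∀ n g c → (∀ m → ι (g m) ≡ egfCoeff c m) → ι (binomialSum n g) ≡ egfCoeff (psum c) n
  binomialSum-egfCoeff zero g c eq = eq 0
  binomialSum-egfCoeff (suc n) g c eq = begin
    ι (binomialSum n (g ∘ suc) ℕ.+ binomialSum n g) ≡⟨ ι-+ (binomialSum n (g ∘ suc)) (binomialSum n g) ⟩
    ι (binomialSum n (g ∘ suc)) + ι (binomialSum n g) ≡⟨ cong₂ _+_ (binomialSum-egfCoeff n (g ∘ suc) (∂ c) (λ m → trans (eq (suc m)) (egfCoeff-suc c m))) (binomialSum-egfCoeff n g c eq) ⟩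
    egfCoeff (psum (∂ c)) n + egfCoeff (psum c) n ≡⟨ egfCoeff-+ n (psum (∂ c)) (psum c) ⟨
    egfCoeff (λ m → psum (∂ c) m + psum c m) n ≡⟨ egfCoeff-cong n (∂-psum c) ⟩
    egfCoeff (∂ (psum c)) n ≡⟨ egfCoeff-suc (psum c) n ⟨
    egfCoeff (psum c) (suc n) ∎
    where open ≡-Reasoning

  bernoulliStep-egfCoeff : ∀ n g c → (∀ m → ι (g m) ≡ egfCoeff c m) → ι (bernoulliStep n g) ≡ egfCoeff (θ c) n
  bernoulliStep-egfCoeff zero g c eq = trans (eq 0) (cong (λ x → ι 1 * (x * 1ℚ)) (sym (ℚ.*-identityˡ (c 0))))
  bernoulliStep-egfCoeff (suc n) g c eq = begin
    ι (binomialSum n (g ∘ suc) ℕ.+ bernoulliStep n (g ∘ suc)) ≡⟨ ι-+ (binomialSum n (g ∘ suc)) (bernoulliStep n (g ∘ suc)) ⟩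
    ι (binomialSum n (g ∘ suc)) + ι (bernoulliStep n (g ∘ suc)) ≡⟨ cong₂ _+_ (binomialSum-egfCoeff n (g ∘ suc) (∂ c) eq′) (bernoulliStep-egfCoeff n (g ∘ suc) (∂ c) eq′) ⟩
    egfCoeff (psum (∂ c)) n + egfCoeff (θ (∂ c)) n ≡⟨ egfCoeff-+ n (psum (∂ c)) (θ (∂ c)) ⟨
    egfCoeff (λ m → psum (∂ c) m + θ (∂ c) m) n ≡⟨ egfCoeff-cong n (∂-θ c) ⟩
    egfCoeff (∂ (θ c)) n ≡⟨ egfCoeff-suc (θ c) n ⟨
    egfCoeff (θ c) (suc n) ∎
    where
    open ≡-Reasoning
    eq′ : ∀ m → ι (g (suc m)) ≡ egfCoeff (∂ c) m
    eq′ m = trans (eq (suc m)) (egfCoeff-suc c m)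

  -- The series is 1/(1-z) = e^x; this is the case j = 0.
  egfCoeff-1 : ∀ n → egfCoeff (λ _ → 1ℚ) n ≡ 1ℚ
  egfCoeff-1 zero = refl
  egfCoeff-1 (suc n) = trans (egfCoeff-suc (λ _ → 1ℚ) n) (trans (egfCoeff-cong n ∂1) (egfCoeff-1 n))
    where
    ∂1 : ∀ m → ∂ (λ _ → 1ℚ) m ≡ 1ℚ
    ∂1 m = trans (cong (λ x → x * 1ℚ - ι m * 1ℚ) (ι-suc m)) (solve 1 (λ i → (con 1ℚ :+ i) :* con 1ℚ :- i :* con 1ℚ := con 1ℚ) refl (ι m))

  polyBernoulliℕ-correct : ∀ j i → ι (polyBernoulliℕ j i) ≡ polyBernoulliB i j
  polyBernoulliℕ-correct zero i = sym (egfCoeff-1 i)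
  polyBernoulliℕ-correct (suc j) i = trans (bernoulliStep-egfCoeff i (polyBernoulliℕ j) (λ m → ι (suc m ℕ.^ j)) (polyBernoulliℕ-correct j))
    (egfCoeff-cong i (λ m → sym (ι-* (suc m) (suc m ℕ.^ j))))

  ½-double : ∀ N → ι N ≡ ½ * ι (N ℕ.+ N)
  ½-double N = trans (solve 1 (λ x → x := con ½ :* (x :+ x)) refl (ι N)) (cong (½ *_) (sym (ι-+ N N)))

open PolyBernoulli using (ι; ½-double; binomialSum; bernoulliStep; polyBernoulliℕ; polyBernoulliℕ-correct)
open import Data.Nat using (_+_)
open ℕSolver.+-*-Solver using (solve; _:=_; _:+_; con)

-- Sums over lists and guarded branches.

Unique-resp-↭ : ∀ {A : Set} {xs ys : List A} → xs ↭ ys → Unique xs → Unique ys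
Unique-resp-↭ {A} p = Permutationₛ.Unique-resp-↭ (setoid A) (↭⇒↭ₛ p)

AllPairs-++⁻ˡ : ∀ {A : Set} {R : A → A → Set} {xs ys : List A} → AllPairs R (xs ++ ys) → AllPairs R xs
AllPairs-++⁻ˡ {xs = []} _ = []
AllPairs-++⁻ˡ {xs = x ∷ xs} (r ∷ rs) = All.++⁻ˡ xs r ∷ AllPairs-++⁻ˡ rs

module _ {X : Set} where
  total : List X → (X → ℕ) → ℕ
  total [] g = 0
  total (x ∷ xs) g = g x + total xs g

  total-++ : ∀ xs ys g → total (xs ++ ys) g ≡ total xs g + total ys g
  total-++ [] ys g = refl
  total-++ (x ∷ xs) ys g = trans (cong (λ r → g x + r) (total-++ xs ys g)) (sym (ℕ.+-assoc (g x) (total xs g) (total ys g)))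

  total-cong : ∀ xs {f g : X → ℕ} → (∀ {x} → x ∈ xs → f x ≡ g x) → total xs f ≡ total xs g
  total-cong [] eq = refl
  total-cong (x ∷ xs) eq = cong₂ _+_ (eq (here refl)) (total-cong xs (eq ∘ there))

  total-+ : ∀ xs (f g : X → ℕ) → total xs (λ x → f x + g x) ≡ total xs f + total xs g
  total-+ [] f g = refl
  total-+ (x ∷ xs) f g = trans (cong (λ r → (f x + g x) + r) (total-+ xs f g))
    (solve 4 (λ a b c d → (a :+ b) :+ (c :+ d) := (a :+ c) :+ (b :+ d)) refl (f x) (g x) (total xs f) (total xs g))

total-concatMap : ∀ {X Y : Set} (f : X → List Y) xs g → total (concatMap f xs) g ≡ total xs (λ x → total (f x) g)
total-concatMap f [] g = refl
total-concatMap f (x ∷ xs) g = trans (total-++ (f x) (concatMap f xs) g) (cong (λ r → total (f x) g + r) (total-concatMap f xs g))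

length-concatMap : ∀ {X Y : Set} (f : X → List Y) xs → length (concatMap f xs) ≡ total xs (length ∘ f)
length-concatMap f [] = refl
length-concatMap f (x ∷ xs) = trans (List.length-++ (f x)) (cong (λ r → length (f x) + r) (length-concatMap f xs))

-- `g` recovers the block in which an element lies, so blocks of distinct indices cannot meet.
concatMap-unique : ∀ {X Y : Set} (f : X → List Y) (g : Y → X) xs → (∀ {x y} → x ∈ xs → y ∈ f x → g y ≡ x) →
  (∀ x → Unique (f x)) → Unique xs → Unique (concatMap f xs)
concatMap-unique f g [] inv uf [] = []
concatMap-unique f g (x ∷ xs) inv uf (x∉ ∷ u) =
  Unique.++⁺ (uf x) (concatMap-unique f g xs (inv ∘ there) uf u) disjoint
  where
  disjoint : ∀ {y} → ¬ (y ∈ f x × y ∈ concatMap f xs)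
  disjoint (y∈ , y∈′) with find (∈-concatMap⁻ f {xs = xs} y∈′)
  ... | x′ , x′∈ , y∈fx′ = All.lookup x∉ x′∈ (trans (sym (inv (here refl) y∈)) (inv (there x′∈) y∈fx′))

guard : ∀ {P X : Set} → Dec P → List X → List X
guard d xs = if does d then xs else []

guard⁻ : ∀ {P X : Set} (d : Dec P) {xs : List X} {x} → x ∈ guard d xs → P × x ∈ xs
guard⁻ (yes p) x∈ = p , x∈

guard⁺ : ∀ {P X : Set} (d : Dec P) {xs : List X} {x} → P → x ∈ xs → x ∈ guard d xs
guard⁺ d p x∈ rewrite dec-true d p = x∈

guard-unique : ∀ {P X : Set} (d : Dec P) {xs : List X} → (P → Unique xs) → Unique (guard d xs)
guard-unique (yes p) u = u p
guard-unique (no _) u = []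

infixr 7 _when_
_when_ : ∀ {P : Set} → ℕ → Dec P → ℕ
k when d = if does d then k else 0

total-guard : ∀ {P X : Set} (d : Dec P) (xs : List X) g → total (guard d xs) g ≡ total xs g when d
total-guard (yes _) xs g = refl
total-guard (no _) xs g = refl

length-guard : ∀ {P X : Set} (d : Dec P) (xs : List X) → length (guard d xs) ≡ length xs when d
length-guard (yes _) xs = refl
length-guard (no _) xs = refl

when-true : ∀ {P : Set} (d : Dec P) {k} → P → k when d ≡ k
when-true d {k} p = cong (if_then k else 0) (dec-true d p)

when-false : ∀ {P : Set} (d : Dec P) {k} → ¬ P → k when d ≡ 0
when-false d {k} ¬p = cong (if_then k else 0) (dec-false d ¬p)

when-+ : ∀ {P : Set} (d : Dec P) j k → (j + k) when d ≡ j when d + k when d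
when-+ (yes _) j k = refl
when-+ (no _) j k = refl

when-cong : ∀ {P : Set} (d : Dec P) {j k} → (P → j ≡ k) → j when d ≡ k when d
when-cong (yes p) eq = eq p
when-cong (no _) eq = refl

if-true : ∀ {P X : Set} (d : Dec P) {x y : X} → P → (if does d then x else y) ≡ x
if-true d p rewrite dec-true d p = refl

if-false : ∀ {P X : Set} (d : Dec P) {x y : X} → ¬ P → (if does d then x else y) ≡ y
if-false d ¬p rewrite dec-false d ¬p = refl

-- Right-to-left minima are found by scanning the reversed word, so an entry put in front of the
-- word is scanned last.
rlMinFrom-∷ʳ-< : ∀ m y xs → MAll.All (y <_) m → All (y <_) xs → rlMinFrom m (xs ∷ʳ y) ≡ suc (rlMinFrom m xs)
rlMinFrom-∷ʳ-< nothing y [] _ [] = refl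
rlMinFrom-∷ʳ-< (just m) y [] (MAll.just y<m) [] = cong (if_then 1 else 0) (dec-true (y ℕ.<? m) y<m)
rlMinFrom-∷ʳ-< nothing y (x ∷ xs) _ (y<x ∷ y<xs) = cong suc (rlMinFrom-∷ʳ-< (just x) y xs (MAll.just y<x) y<xs)
rlMinFrom-∷ʳ-< (just m) y (x ∷ xs) (MAll.just y<m) (y<x ∷ y<xs) with x ℕ.<ᵇ m
... | true = cong suc (rlMinFrom-∷ʳ-< (just x) y xs (MAll.just y<x) y<xs)
... | false = rlMinFrom-∷ʳ-< (just m) y xs (MAll.just y<m) y<xs

-- The running minimum only decreases, so once it has met a value at most `y` it stays at most `y`.
rlMinFrom-∷ʳ-≮ : ∀ m y xs → MAny.Any (λ x → ¬ y < x) m ⊎ Any (λ x → ¬ y < x) xs → rlMinFrom m (xs ∷ʳ y) ≡ rlMinFrom m xs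
rlMinFrom-∷ʳ-≮ (just m) y [] (inj₁ (MAny.just y≮m)) = cong (if_then 1 else 0) (dec-false (y ℕ.<? m) y≮m)
rlMinFrom-∷ʳ-≮ nothing y (x ∷ xs) (inj₂ (here y≮x)) = cong suc (rlMinFrom-∷ʳ-≮ (just x) y xs (inj₁ (MAny.just y≮x)))
rlMinFrom-∷ʳ-≮ nothing y (x ∷ xs) (inj₂ (there y≮xs)) = cong suc (rlMinFrom-∷ʳ-≮ (just x) y xs (inj₂ y≮xs))
rlMinFrom-∷ʳ-≮ (just m) y (x ∷ xs) blocked with x ℕ.<? m
... | yes x<m = trans (if-true (x ℕ.<? m) x<m) (trans (cong suc (rlMinFrom-∷ʳ-≮ (just x) y xs (to blocked))) (sym (if-true (x ℕ.<? m) x<m)))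
  where
  to : MAny.Any (λ x → ¬ y < x) (just m) ⊎ Any (λ x → ¬ y < x) (x ∷ xs) → MAny.Any (λ x → ¬ y < x) (just x) ⊎ Any (λ x → ¬ y < x) xs
  to (inj₁ (MAny.just y≮m)) = inj₁ (MAny.just (λ y<x → y≮m (ℕ.<-trans y<x x<m)))
  to (inj₂ (here y≮x)) = inj₁ (MAny.just y≮x)
  to (inj₂ (there y≮xs)) = inj₂ y≮xs
... | no x≮m = trans (if-false (x ℕ.<? m) x≮m) (trans (rlMinFrom-∷ʳ-≮ (just m) y xs (to blocked)) (sym (if-false (x ℕ.<? m) x≮m)))
  where
  to : MAny.Any (λ x → ¬ y < x) (just m) ⊎ Any (λ x → ¬ y < x) (x ∷ xs) → MAny.Any (λ x → ¬ y < x) (just m) ⊎ Any (λ x → ¬ y < x) xs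
  to (inj₁ y≮m) = inj₁ y≮m
  to (inj₂ (here y≮x)) = inj₁ (MAny.just (λ y<m → y≮x (ℕ.<-≤-trans y<m (ℕ.≮⇒≥ x≮m))))
  to (inj₂ (there y≮xs)) = inj₂ y≮xs

-- Comparator sweeps and their inverses.

module _ {n : ℕ} where
  private
    A = Fin n

  _<?_ : (a b : A) → Dec (a Fin.< b)
  a <? b = a Fin.<? b

  lo hi : A → A → A
  lo a b = if does (a <? b) then a else b
  hi a b = if does (a <? b) then b else a

  lo-< : ∀ {a b} → a Fin.< b → lo a b ≡ a
  lo-< {a} {b} a<b = cong (if_then a else b) (dec-true (a <? b) a<b)
  hi-< : ∀ {a b} → a Fin.< b → hi a b ≡ b
  hi-< {a} {b} a<b = cong (if_then b else a) (dec-true (a <? b) a<b)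
  lo-≮ : ∀ {a b} → ¬ a Fin.< b → lo a b ≡ b
  lo-≮ {a} {b} a≮b = cong (if_then a else b) (dec-false (a <? b) a≮b)
  hi-≮ : ∀ {a b} → ¬ a Fin.< b → hi a b ≡ a
  hi-≮ {a} {b} a≮b = cong (if_then b else a) (dec-false (a <? b) a≮b)

  sweep : A → List A → List A × A
  sweep c [] = [] , c
  sweep c (v ∷ vs) = let (ws , h) = sweep (hi c v) vs in lo c v ∷ ws , h

  -- The last chip of `zs` sweeps first, since it stands on site p; a later sweep starts one site
  -- further left, and its chip comes to rest in front of those already carried out.
  run : List A → List A → List A × List A
  run [] xs = xs , []
  run (z ∷ zs) xs = let (vs , R) = run zs xs; (ws , h) = sweep z vs in ws , h ∷ R

  lo-hi-↭ : ∀ a b (xs : List A) → lo a b ∷ hi a b ∷ xs ↭ a ∷ b ∷ xs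
  lo-hi-↭ a b xs with a <? b
  ... | yes a<b rewrite lo-< a<b | hi-< a<b = ↭-refl
  ... | no a≮b rewrite lo-≮ a≮b | hi-≮ a≮b = swap b a ↭-refl

  sweep-↭ : ∀ c vs → proj₂ (sweep c vs) ∷ proj₁ (sweep c vs) ↭ c ∷ vs
  sweep-↭ c [] = ↭-refl
  sweep-↭ c (v ∷ vs) = ↭-trans (swap _ _ ↭-refl) (↭-trans (prep (lo c v) (sweep-↭ (hi c v) vs)) (lo-hi-↭ c v vs))

  -- A comparator with outputs o < m received them in either order; outputs that are not increasing have no input.
  branch : A → A × List A → List (A × List A)
  branch o (m , w) = guard (o <? m) ((o , m ∷ w) ∷ (m , o ∷ w) ∷ [])

  -- Comparators are undone from the right end, where `h` comes out; the choice made in one fixes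
  -- the chip that its left neighbour must have sent on.
  unsweep : A → List A → List (A × List A)
  unsweep h [] = (h , []) ∷ []
  unsweep h (o ∷ os) = concatMap (branch o) (unsweep h os)

  data Branch (o : A) (m : A) (w : List A) : A × List A → Set where
    keep : o Fin.< m → Branch o m w (o , m ∷ w)
    exch : o Fin.< m → Branch o m w (m , o ∷ w)

  branch⁻ : ∀ {o m w p} → p ∈ branch o (m , w) → Branch o m w p
  branch⁻ {o} {m} p∈ with guard⁻ (o <? m) p∈
  ... | o<m , here refl = keep o<m
  ... | o<m , there (here refl) = exch o<m

  branch⁺ : ∀ {o m w p} → Branch o m w p → p ∈ branch o (m , w)
  branch⁺ (keep o<m) = guard⁺ (_ <? _) o<m (here refl)
  branch⁺ (exch o<m) = guard⁺ (_ <? _) o<m (there (here refl))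

  unsweep-∷⁻ : ∀ {h o os p} → p ∈ unsweep h (o ∷ os) → ∃[ m ] ∃[ w ] ((m , w) ∈ unsweep h os × Branch o m w p)
  unsweep-∷⁻ {h} {o} {os} p∈ with find (∈-concatMap⁻ (branch o) {xs = unsweep h os} p∈)
  ... | (m , w) , mw∈ , p∈b = m , w , mw∈ , branch⁻ p∈b

  unsweep-∷⁺ : ∀ {h o os p m w} → (m , w) ∈ unsweep h os → Branch o m w p → p ∈ unsweep h (o ∷ os)
  unsweep-∷⁺ {o = o} mw∈ b = ∈-concatMap⁺ (branch o) (lose mw∈ (branch⁺ b))

  sweep-unsweep : ∀ {h os z w} → (z , w) ∈ unsweep h os → sweep z w ≡ (os , h)
  sweep-unsweep {os = []} (here refl) = refl
  sweep-unsweep {os = o ∷ os} p∈ with unsweep-∷⁻ {os = os} p∈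
  ... | m , w , mw∈ , keep o<m rewrite lo-< o<m | hi-< o<m | sweep-unsweep {os = os} mw∈ = refl
  ... | m , w , mw∈ , exch o<m rewrite lo-≮ (ℕ.<⇒≯ o<m) | hi-≮ (ℕ.<⇒≯ o<m) | sweep-unsweep {os = os} mw∈ = refl

  unsweep-sweep : ∀ z w → Unique (z ∷ w) → (z , w) ∈ unsweep (proj₂ (sweep z w)) (proj₁ (sweep z w))
  unsweep-sweep z [] u = here refl
  unsweep-sweep z (v ∷ w) u@((z≢v ∷ _) ∷ _) = unsweep-∷⁺ {os = proj₁ (sweep (hi z v) w)} (unsweep-sweep (hi z v) w u′) b
    where
    u′ : Unique (hi z v ∷ w)
    u′ with Unique-resp-↭ (↭-sym (lo-hi-↭ z v w)) u
    ... | _ ∷ u″ = u″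
    b : Branch (lo z v) (hi z v) w (z , v ∷ w)
    b with z <? v
    ... | yes z<v rewrite lo-< z<v | hi-< z<v = keep z<v
    ... | no z≮v rewrite lo-≮ z≮v | hi-≮ z≮v = exch (ℕ.≤∧≢⇒< (ℕ.≮⇒≥ z≮v) (λ eq → z≢v (sym (Fin.toℕ-injective eq))))

  unsweep-↭ : ∀ {h os z w} → (z , w) ∈ unsweep h os → z ∷ w ↭ h ∷ os
  unsweep-↭ {h} {os} {z} {w} p∈ = subst (λ s → z ∷ w ↭ proj₂ s ∷ proj₁ s) (sweep-unsweep {os = os} p∈) (↭-sym (sweep-↭ z w))

  unsweep-unique : ∀ h os → Unique (unsweep h os)
  unsweep-unique h [] = [] ∷ []
  unsweep-unique h (o ∷ os) = concatMap-unique (branch o) back (unsweep h os) (λ _ → inv ∘ branch⁻) u (unsweep-unique h os)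
    where
    -- Running the first comparator forward recovers the pair from which a branch was built.
    back : A × List A → A × List A
    back (z , []) = z , []
    back (z , v ∷ w) = hi z v , w
    inv : ∀ {m w p} → Branch o m w p → back p ≡ (m , w)
    inv (keep o<m) = cong (_, _) (hi-< o<m)
    inv (exch o<m) = cong (_, _) (hi-≮ (ℕ.<⇒≯ o<m))
    u : ∀ p → Unique (branch o p)
    u (m , w) = guard-unique (o <? m) (λ o<m → ((λ eq → ℕ.<⇒≢ o<m (cong (toℕ ∘ proj₁) eq)) ∷ []) ∷ [] ∷ [])

  -- A comparator leaves the smaller chip behind, so a sweep lowers the row entrywise.
  unsweep-<⇒< : ∀ {h os z w} {r : A} → (z , w) ∈ unsweep h os → All (Fin._< r) w → All (Fin._< r) os
  unsweep-<⇒< {os = []} _ _ = []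
  unsweep-<⇒< {os = o ∷ os} p∈ w<r with unsweep-∷⁻ {os = os} p∈ | w<r
  ... | m , w , mw∈ , keep o<m | m<r ∷ w<r′ = ℕ.<-trans o<m m<r ∷ unsweep-<⇒< {os = os} mw∈ w<r′
  ... | m , w , mw∈ , exch o<m | o<r ∷ w<r′ = o<r ∷ unsweep-<⇒< {os = os} mw∈ w<r′

  -- A comparator sends on the larger chip, so the chip that leaves the row is the maximum of its
  -- sweep.
  unsweep-<h : ∀ {h os z w} → (z , w) ∈ unsweep h os → z Fin.≤ h × All (Fin._< h) os
  unsweep-<h {os = []} (here refl) = ℕ.≤-refl , []
  unsweep-<h {os = o ∷ os} p∈ with unsweep-∷⁻ {os = os} p∈
  ... | m , w , mw∈ , keep o<m = let (m≤h , os<h) = unsweep-<h {os = os} mw∈ in ℕ.<⇒≤ (ℕ.<-≤-trans o<m m≤h) , ℕ.<-≤-trans o<m m≤h ∷ os<h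
  ... | m , w , mw∈ , exch o<m = let (m≤h , os<h) = unsweep-<h {os = os} mw∈ in m≤h , ℕ.<-≤-trans o<m m≤h ∷ os<h

  start : A → A × List A → List (List A × List A)
  start o (m , w) = guard (o <? m) ((o ∷ [] , m ∷ w) ∷ [])

  cons : A → List A × List A → List A × List A
  cons z (zs , xs) = z ∷ zs , xs

  -- The head of `R` came out of the last sweep, so it is put back first; the single entry of the
  -- base case came out of the sweep that begins on site p.
  preimages : List A → List A → List (List A × List A)
  preimages [] vs = []
  preimages (h ∷ []) [] = []
  preimages (h ∷ []) (o ∷ os) = concatMap (start o) (unsweep h os)
  preimages (h ∷ R@(_ ∷ _)) vs = concatMap (λ (z , w) → map (cons z) (preimages R w)) (unsweep h vs)

  -- The last chip of zs and the first chip of xs share the site p, so only one of their two orders is kept.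
  data Ascending : List A → List A → Set where
    meet : ∀ {z x xs} → z Fin.< x → Ascending (z ∷ []) (x ∷ xs)
    skip : ∀ {z zs xs} → Ascending zs xs → Ascending (z ∷ zs) xs

  preimages⁻ : ∀ R vs {zs xs} → (zs , xs) ∈ preimages R vs → Ascending zs xs × run zs xs ≡ (vs , R)
  preimages⁻ (h ∷ []) (o ∷ os) p∈ with find (∈-concatMap⁻ (start o) {xs = unsweep h os} p∈)
  ... | (m , w) , mw∈ , p∈f with guard⁻ (o <? m) p∈f
  ...   | o<m , here refl = meet o<m , cong (λ (ws , h) → ws , h ∷ []) (sweep-unsweep {os = o ∷ os} (unsweep-∷⁺ {os = os} mw∈ (keep o<m)))
  preimages⁻ (h ∷ R@(_ ∷ _)) vs p∈ with find (∈-concatMap⁻ _ {xs = unsweep h vs} p∈)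
  ... | (z , w) , zw∈ , p∈f with ∈-map⁻ (cons z) p∈f
  ...   | (zs , xs) , q∈ , refl with preimages⁻ R w q∈
  ...     | asc , eq rewrite eq | sweep-unsweep {os = vs} zw∈ = skip asc , refl

  run-↭ : ∀ zs xs → proj₁ (run zs xs) ++ proj₂ (run zs xs) ↭ zs ++ xs
  run-↭ [] xs = ↭-reflexive (List.++-identityʳ xs)
  run-↭ (z ∷ zs) xs = let (vs , R) = run zs xs; (ws , h) = sweep z vs in
    ↭-trans (shift h ws R) (↭-trans (++⁺ʳ R (sweep-↭ z vs)) (prep z (run-↭ zs xs)))

  preimages⁺ : ∀ zs xs → Unique (zs ++ xs) → Ascending zs xs → (zs , xs) ∈ preimages (proj₂ (run zs xs)) (proj₁ (run zs xs))
  preimages⁺ (z ∷ []) (x ∷ xs) (_ ∷ u) (meet z<x) rewrite lo-< z<x | hi-< z<x =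
    ∈-concatMap⁺ (start z) (lose (unsweep-sweep x xs u) (guard⁺ (z <? x) z<x (here refl)))
  preimages⁺ (z ∷ zs@(_ ∷ _)) xs (z∉ ∷ u) (skip asc) =
    ∈-concatMap⁺ _ (lose (unsweep-sweep z (proj₁ (run zs xs)) u′) (∈-map⁺ (cons z) (preimages⁺ zs xs u asc)))
    where
    u′ : Unique (z ∷ proj₁ (run zs xs))
    u′ with Unique-resp-↭ (prep z (↭-sym (run-↭ zs xs))) (z∉ ∷ u)
    ... | z∉′ ∷ u″ = All.++⁻ˡ _ z∉′ ∷ AllPairs-++⁻ˡ u″

  preimages-unique : ∀ R vs → Unique (preimages R vs)
  preimages-unique [] vs = []
  preimages-unique (h ∷ []) [] = []
  preimages-unique (h ∷ []) (o ∷ os) = concatMap-unique (start o) back (unsweep h os) inv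
    (λ (m , w) → guard-unique (o <? m) (λ _ → [] ∷ [])) (unsweep-unique h os)
    where
    back : List A × List A → A × List A
    back (zs , []) = h , []
    back (zs , m ∷ w) = m , w
    inv : ∀ {p q} → p ∈ unsweep h os → q ∈ start o p → back q ≡ p
    inv {m , w} _ q∈ with guard⁻ (o <? m) q∈
    ... | _ , here refl = refl
  preimages-unique (h ∷ R@(_ ∷ _)) vs = concatMap-unique _ back (unsweep h vs) inv
    (λ (z , w) → Unique.map⁺ (λ { refl → refl }) (preimages-unique R w)) (unsweep-unique h vs)
    where
    back : List A × List A → A × List A
    back ([] , xs) = h , []
    -- Repeating the earlier sweeps recovers the row `w`; the clause for an empty list is a filler,
    -- as no listed pair has that form.
    back (z ∷ zs , xs) = z , proj₁ (run zs xs)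
    inv : ∀ {p q} → p ∈ unsweep h vs → q ∈ map (cons (proj₁ p)) (preimages R (proj₂ p)) → back q ≡ p
    inv {z , w} _ q∈ with ∈-map⁻ (cons z) q∈
    ... | (zs , xs) , q∈′ , refl = cong (λ s → z , proj₁ s) (proj₂ (preimages⁻ R w q∈′))


  -- Counting preimages by maxima and minima.

  rank : A → ℕ
  rank k = suc (toℕ k)

  maxima minima : List A → ℕ
  maxima vs = lrMaxima (map rank vs)
  minima R = rlMinima (map rank R)

  -- `maxima (o ∷ vs)` reduces to `suc (maximaOver o vs)`; the bound `o` may also be a chip outside
  -- the row.
  maximaOver : A → List A → ℕ
  maximaOver o vs = lrMaxFrom (just (rank o)) (map rank vs)

  maximaOver-< : ∀ {o x} vs → o Fin.< x → maximaOver o (x ∷ vs) ≡ suc (maximaOver x vs)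
  maximaOver-< {o} {x} vs o<x = cong (if_then suc (maximaOver x vs) else maximaOver o vs) (dec-true (o <? x) o<x)

  maximaOver-≮ : ∀ {o x} vs → ¬ o Fin.< x → maximaOver o (x ∷ vs) ≡ maximaOver o vs
  maximaOver-≮ {o} {x} vs o≮x = cong (if_then suc (maximaOver x vs) else maximaOver o vs) (dec-false (o <? x) o≮x)

  total-unsweep : ∀ h o os g → total (unsweep h (o ∷ os)) g ≡
    total (unsweep h os) (λ (m , w) → (g (o , m ∷ w) + g (m , o ∷ w)) when (o <? m))
  total-unsweep h o os g = trans (total-concatMap (branch o) (unsweep h os) g)
    (total-cong (unsweep h os) (λ {(m , w)} _ → trans (total-guard (o <? m) _ g)
      (cong (λ k → (g (o , m ∷ w) + k) when (o <? m)) (ℕ.+-identityʳ (g (m , o ∷ w))))))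

  total-when-+ : ∀ o (ps : List (A × List A)) (f g : A × List A → ℕ) →
    total ps (λ p → (f p + g p) when (o <? proj₁ p)) ≡
    total ps (λ p → f p when (o <? proj₁ p)) + total ps (λ p → g p when (o <? proj₁ p))
  total-when-+ o ps f g = trans (total-cong ps (λ {p} _ → when-+ (o <? proj₁ p) (f p) (g p))) (total-+ ps _ _)

  -- If x exceeds `o`, the two inputs of its comparator give the two terms of Pascal's rule: in
  -- order, `m` is a further maximum above x; exchanged, x is hidden below the carried `m`. An x not
  -- above `o` offers no choice.
  binomialSum-unsweep : ∀ {h} o os g → o Fin.< h → All (Fin._< h) os →
    total (unsweep h os) (λ (m , w) → g (maximaOver m w) when (o <? m)) ≡ binomialSum (maximaOver o os) g
  -- Under the fixed bound `o`, an in-order comparator at x puts `m` in its place, after which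
  -- maxima are counted over `m` and give the binomial sum; an exchanged one leaves x as the new
  -- fixed bound.
  bernoulliStep-unsweep : ∀ {h} o os g → o Fin.< h → All (Fin._< h) os →
    total (unsweep h os) (λ (m , w) → g (maximaOver o w) when (o <? m)) ≡ bernoulliStep (maximaOver o os) g
  binomialSum-unsweep o [] g o<h [] = trans (ℕ.+-identityʳ _) (when-true (o <? _) o<h)
  binomialSum-unsweep {h} o (x ∷ os) g o<h (x<h ∷ os<h) with o <? x
  ... | yes o<x = begin
    total (unsweep h (x ∷ os)) (λ (m , w) → g (maximaOver m w) when (o <? m)) ≡⟨ total-unsweep h x os _ ⟩
    total (unsweep h os) (λ (m , w) → (g (maximaOver x (m ∷ w)) when (o <? x) + g (maximaOver m (x ∷ w)) when (o <? m)) when (x <? m))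
      ≡⟨ total-cong (unsweep h os) (λ {(m , w)} _ → when-cong (x <? m) (λ x<m → cong₂ _+_
           (trans (when-true (o <? x) o<x) (cong g (maximaOver-< w x<m)))
           (trans (when-true (o <? m) (ℕ.<-trans o<x x<m)) (cong g (maximaOver-≮ w (ℕ.<⇒≯ x<m)))))) ⟩
    total (unsweep h os) (λ (m , w) → (g (suc (maximaOver m w)) + g (maximaOver m w)) when (x <? m))
      ≡⟨ total-when-+ x (unsweep h os) _ _ ⟩
    _ ≡⟨ cong₂ _+_ (binomialSum-unsweep x os (g ∘ suc) x<h os<h) (binomialSum-unsweep x os g x<h os<h) ⟩
    binomialSum (suc (maximaOver x os)) g ≡⟨ cong (λ i → binomialSum i g) (maximaOver-< os o<x) ⟨
    binomialSum (maximaOver o (x ∷ os)) g ∎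
    where open ≡-Reasoning
  ... | no o≮x = begin
    total (unsweep h (x ∷ os)) (λ (m , w) → g (maximaOver m w) when (o <? m)) ≡⟨ total-unsweep h x os _ ⟩
    total (unsweep h os) (λ (m , w) → (g (maximaOver x (m ∷ w)) when (o <? x) + g (maximaOver m (x ∷ w)) when (o <? m)) when (x <? m))
      ≡⟨ total-cong (unsweep h os) (λ {(m , w)} _ → step m w) ⟩
    total (unsweep h os) (λ (m , w) → g (maximaOver m w) when (o <? m)) ≡⟨ binomialSum-unsweep o os g o<h os<h ⟩
    binomialSum (maximaOver o os) g ≡⟨ cong (λ i → binomialSum i g) (maximaOver-≮ os o≮x) ⟨
    binomialSum (maximaOver o (x ∷ os)) g ∎
    where
    open ≡-Reasoning
    -- In-order input at x would make x the chip sent on by the comparator with output `o`, which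
    -- requires o < x; only the exchange remains.
    step : ∀ m w → (g (maximaOver x (m ∷ w)) when (o <? x) + g (maximaOver m (x ∷ w)) when (o <? m)) when (x <? m)
      ≡ g (maximaOver m w) when (o <? m)
    step m w with x <? m
    ... | yes x<m = trans (when-true (x <? m) x<m) (cong₂ _+_ (when-false (o <? x) o≮x)
            (cong (λ k → g k when (o <? m)) (maximaOver-≮ w (ℕ.<⇒≯ x<m))))
    ... | no x≮m = trans (when-false (x <? m) x≮m) (sym (when-false (o <? m) (λ o<m → x≮m (ℕ.≤-<-trans {toℕ x} (ℕ.≮⇒≥ o≮x) o<m))))
  bernoulliStep-unsweep o [] g o<h [] = trans (ℕ.+-identityʳ _) (when-true (o <? _) o<h)
  bernoulliStep-unsweep {h} o (x ∷ os) g o<h (x<h ∷ os<h) with o <? x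
  ... | yes o<x = begin
    total (unsweep h (x ∷ os)) (λ (m , w) → g (maximaOver o w) when (o <? m)) ≡⟨ total-unsweep h x os _ ⟩
    total (unsweep h os) (λ (m , w) → (g (maximaOver o (m ∷ w)) when (o <? x) + g (maximaOver o (x ∷ w)) when (o <? m)) when (x <? m))
      ≡⟨ total-cong (unsweep h os) (λ {(m , w)} _ → when-cong (x <? m) (λ x<m → cong₂ _+_
           (trans (when-true (o <? x) o<x) (cong g (maximaOver-< w (ℕ.<-trans o<x x<m))))
           (trans (when-true (o <? m) (ℕ.<-trans o<x x<m)) (cong g (maximaOver-< w o<x))))) ⟩
    total (unsweep h os) (λ (m , w) → (g (suc (maximaOver m w)) + g (suc (maximaOver x w))) when (x <? m))
      ≡⟨ total-when-+ x (unsweep h os) _ _ ⟩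
    _ ≡⟨ cong₂ _+_ (binomialSum-unsweep x os (g ∘ suc) x<h os<h) (bernoulliStep-unsweep x os (g ∘ suc) x<h os<h) ⟩
    bernoulliStep (suc (maximaOver x os)) g ≡⟨ cong (λ i → bernoulliStep i g) (maximaOver-< os o<x) ⟨
    bernoulliStep (maximaOver o (x ∷ os)) g ∎
    where open ≡-Reasoning
  ... | no o≮x = begin
    total (unsweep h (x ∷ os)) (λ (m , w) → g (maximaOver o w) when (o <? m)) ≡⟨ total-unsweep h x os _ ⟩
    total (unsweep h os) (λ (m , w) → (g (maximaOver o (m ∷ w)) when (o <? x) + g (maximaOver o (x ∷ w)) when (o <? m)) when (x <? m))
      ≡⟨ total-cong (unsweep h os) (λ {(m , w)} _ → step m w) ⟩
    total (unsweep h os) (λ (m , w) → g (maximaOver o w) when (o <? m)) ≡⟨ bernoulliStep-unsweep o os g o<h os<h ⟩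
    bernoulliStep (maximaOver o os) g ≡⟨ cong (λ i → bernoulliStep i g) (maximaOver-≮ os o≮x) ⟨
    bernoulliStep (maximaOver o (x ∷ os)) g ∎
    where
    open ≡-Reasoning
    step : ∀ m w → (g (maximaOver o (m ∷ w)) when (o <? x) + g (maximaOver o (x ∷ w)) when (o <? m)) when (x <? m)
      ≡ g (maximaOver o w) when (o <? m)
    step m w with x <? m
    ... | yes x<m = trans (when-true (x <? m) x<m) (cong₂ _+_ (when-false (o <? x) o≮x)
            (cong (λ k → g k when (o <? m)) (maximaOver-≮ w o≮x)))
    ... | no x≮m = trans (when-false (x <? m) x≮m) (sym (when-false (o <? m) (λ o<m → x≮m (ℕ.≤-<-trans {toℕ x} (ℕ.≮⇒≥ o≮x) o<m))))

  -- The first entry of a row is always a maximum, and its two inputs give the two summands of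
  -- `bernoulliStep` at `suc`: undoing one sweep is one step of the recurrence in j.
  maxima-unsweep : ∀ {h} vs g → All (Fin._< h) vs → total (unsweep h vs) (λ (z , w) → g (maxima w)) ≡ bernoulliStep (maxima vs) g
  maxima-unsweep [] g [] = ℕ.+-identityʳ (g 0)
  maxima-unsweep {h} (o ∷ os) g (o<h ∷ os<h) = begin
    total (unsweep h (o ∷ os)) (λ (z , w) → g (maxima w)) ≡⟨ total-unsweep h o os _ ⟩
    total (unsweep h os) (λ (m , w) → (g (suc (maximaOver m w)) + g (suc (maximaOver o w))) when (o <? m))
      ≡⟨ total-when-+ o (unsweep h os) _ _ ⟩
    _ ≡⟨ cong₂ _+_ (binomialSum-unsweep o os (g ∘ suc) o<h os<h) (bernoulliStep-unsweep o os (g ∘ suc) o<h os<h) ⟩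
    bernoulliStep (maxima (o ∷ os)) g ∎
    where open ≡-Reasoning

  -- The only undoing that keeps `h` out of the row exchanges at every comparator, so that `h`
  -- itself was the sweeping chip.
  total-unsweep-collapse : ∀ {h} vs (k : A × List A → ℕ) → All (Fin._< h) vs →
    (∀ z w → h ∈ w → k (z , w) ≡ 0) → total (unsweep h vs) k ≡ k (h , vs)
  total-unsweep-collapse [] k [] k0 = ℕ.+-identityʳ _
  total-unsweep-collapse {h} (o ∷ os) k (o<h ∷ os<h) k0 = trans (total-unsweep h o os k)
    (trans (total-unsweep-collapse os _ os<h
        (λ m w h∈w → trans (cong₂ (λ a b → (a + b) when (o <? m)) (k0 o (m ∷ w) (there h∈w)) (k0 m (o ∷ w) (there h∈w))) (zero-when (o <? m))))
      (trans (when-true (o <? h) o<h) (cong (_+ k (h , o ∷ os)) (k0 o (h ∷ os) (here refl)))))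
    where
    zero-when : ∀ {P : Set} (d : Dec P) → 0 when d ≡ 0
    zero-when (yes _) = refl
    zero-when (no _) = refl

  -- For the two parts of a permutation this says that the left part consists of the smallest
  -- labels.
  Below : List A → List A → Set
  Below vs R = All (λ r → All (Fin._< r) vs) R

  -- A chip carried out is the maximum of its sweep, and later sweeps only lower the row.
  preimages-below : ∀ R vs {q} → q ∈ preimages R vs → Below vs R
  preimages-below (h ∷ []) (o ∷ os) p∈ with find (∈-concatMap⁻ (start o) {xs = unsweep h os} p∈)
  ... | (m , w) , mw∈ , p∈f = proj₂ (unsweep-<h {os = o ∷ os} (unsweep-∷⁺ {os = os} mw∈ (keep (proj₁ (guard⁻ (o <? m) p∈f))))) ∷ []
  preimages-below (h ∷ R@(_ ∷ _)) vs p∈ with find (∈-concatMap⁻ _ {xs = unsweep h vs} p∈)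
  ... | (z , w) , zw∈ , p∈f with ∈-map⁻ (cons z) p∈f
  ...   | (zs , xs) , q∈ , refl = proj₂ (unsweep-<h {os = vs} zw∈) ∷ All.map (unsweep-<⇒< {os = vs} zw∈) (preimages-below R w q∈)

  minima-∷-< : ∀ h R → All (h Fin.<_) R → minima (h ∷ R) ≡ suc (minima R)
  minima-∷-< h R h<R = trans (cong (rlMinFrom nothing) (List.unfold-reverse (rank h) (map rank R)))
    (rlMinFrom-∷ʳ-< nothing (rank h) (reverse (map rank R)) MAll.nothing
      (All-resp-↭ (↭-sym (↭-reverse (map rank R))) (All.map⁺ (All.map s≤s h<R))))

  minima-∷-≮ : ∀ h R → Any (λ r → ¬ h Fin.< r) R → minima (h ∷ R) ≡ minima R
  minima-∷-≮ h R h≮R = trans (cong (rlMinFrom nothing) (List.unfold-reverse (rank h) (map rank R)))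
    (rlMinFrom-∷ʳ-≮ nothing (rank h) (reverse (map rank R)) (inj₂
      (Any-resp-↭ (↭-sym (↭-reverse (map rank R))) (Any.map⁺ (Any.map (λ h≮r → h≮r ∘ ℕ.s≤s⁻¹) h≮R)))))

  length-preimages : ∀ h r R vs → length (preimages (h ∷ r ∷ R) vs) ≡ total (unsweep h vs) (λ (z , w) → length (preimages (r ∷ R) w))
  length-preimages h r R vs = trans (length-concatMap _ (unsweep h vs))
    (total-cong (unsweep h vs) (λ {(z , w)} _ → List.length-map (cons z) (preimages (r ∷ R) w)))

  preimages-count : ∀ h R o os → Below (o ∷ os) (h ∷ R) →
    length (preimages (h ∷ R) (o ∷ os)) + length (preimages (h ∷ R) (o ∷ os)) ≡ polyBernoulliℕ (minima (h ∷ R)) (maxima (o ∷ os))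
  -- Here j = 1 and `bernoulliStep` at `suc` has two summands. With a constant `g` it does not
  -- matter over which bound maxima are counted, so each summand equals the number of listed inputs.
  preimages-count h [] o os ((o<h ∷ os<h) ∷ []) = cong₂ _+_
    (trans len (binomialSum-unsweep o os (λ _ → 1) o<h os<h)) (trans len (bernoulliStep-unsweep o os (λ _ → 1) o<h os<h))
    where
    len : length (preimages (h ∷ []) (o ∷ os)) ≡ total (unsweep h os) (λ (m , w) → 1 when (o <? m))
    len = trans (length-concatMap (start o) (unsweep h os)) (total-cong (unsweep h os) (λ {(m , w)} _ → length-guard (o <? m) _))
  preimages-count h (r ∷ R) o os (vs<h ∷ vs<R) with All.all? (h <?_) (r ∷ R)
  -- `h` is a right-to-left minimum: it may enter the left row without breaking `Below`, so every
  -- undoing of its sweep contributes.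
  ... | yes h<R = begin
    length (preimages (h ∷ r ∷ R) vs) + length (preimages (h ∷ r ∷ R) vs) ≡⟨ cong₂ _+_ (length-preimages h r R vs) (length-preimages h r R vs) ⟩
    total (unsweep h vs) N + total (unsweep h vs) N ≡⟨ total-+ (unsweep h vs) N N ⟨
    total (unsweep h vs) (λ p → N p + N p) ≡⟨ total-cong (unsweep h vs) (λ {(z , w)} → rec z w) ⟩
    total (unsweep h vs) (λ (z , w) → polyBernoulliℕ (minima (r ∷ R)) (maxima w)) ≡⟨ maxima-unsweep vs (polyBernoulliℕ (minima (r ∷ R))) vs<h ⟩
    polyBernoulliℕ (suc (minima (r ∷ R))) (maxima vs) ≡⟨ cong (λ j → polyBernoulliℕ j (maxima vs)) (minima-∷-< h (r ∷ R) h<R) ⟨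
    polyBernoulliℕ (minima (h ∷ r ∷ R)) (maxima vs) ∎
    where
    open ≡-Reasoning
    vs = o ∷ os
    N : A × List A → ℕ
    N (z , w) = length (preimages (r ∷ R) w)
    rec : ∀ z w → (z , w) ∈ unsweep h vs → N (z , w) + N (z , w) ≡ polyBernoulliℕ (minima (r ∷ R)) (maxima w)
    rec z w zw∈ with unsweep-↭ {os = vs} zw∈
    rec z [] zw∈ | p with ↭-length p
    ... | ()
    rec z (o′ ∷ os′) zw∈ | p = preimages-count r R o′ os′
      (All.zipWith (λ (h<r , vs<r) → All.tail (All-resp-↭ (↭-sym p) (h<r ∷ vs<r))) (h<R , vs<R))
  -- A row that contains `h` is not below some remaining right entry and has no preimages; only the
  -- undoing that leaves the row unchanged survives.
  ... | no h≮R = begin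
    length (preimages (h ∷ r ∷ R) vs) + length (preimages (h ∷ r ∷ R) vs) ≡⟨ cong₂ _+_ collapse collapse ⟩
    length (preimages (r ∷ R) vs) + length (preimages (r ∷ R) vs) ≡⟨ preimages-count r R o os vs<R ⟩
    polyBernoulliℕ (minima (r ∷ R)) (maxima vs) ≡⟨ cong (λ j → polyBernoulliℕ j (maxima vs)) (minima-∷-≮ h (r ∷ R) ≮R) ⟨
    polyBernoulliℕ (minima (h ∷ r ∷ R)) (maxima vs) ∎
    where
    open ≡-Reasoning
    vs = o ∷ os
    ≮R : Any (λ r → ¬ h Fin.< r) (r ∷ R)
    ≮R = All.¬All⇒Any¬ (h <?_) (r ∷ R) h≮R
    dead : ∀ z w → h ∈ w → length (preimages (r ∷ R) w) ≡ 0
    dead z w h∈w with preimages (r ∷ R) w in eq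
    ... | [] = refl
    ... | q ∷ _ = let (s , s∈ , h≮s) = find ≮R in
      ⊥-elim (h≮s (All.lookup (All.lookup (preimages-below (r ∷ R) w (subst (q ∈_) (sym eq) (here refl))) s∈) h∈w))
    collapse : length (preimages (h ∷ r ∷ R) vs) ≡ length (preimages (r ∷ R) vs)
    collapse = trans (length-preimages h r R vs) (total-unsweep-collapse vs _ vs<h dead)

∈-toList⁻ : ∀ {X : Set} {m x} {xs : Vec X m} → x ∈ toList xs → ∃[ i ] lookup xs i ≡ x
∈-toList⁻ {xs = x ∷ xs} (here refl) = Fin.zero , refl
∈-toList⁻ {xs = x ∷ xs} (there x∈) = let (i , e) = ∈-toList⁻ x∈ in Fin.suc i , e

-- Topplings that carry out the sweeps.

module _ {n : ℕ} where
  private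
    A = Fin n

  -- The list follows the order of the word, so that a comparator acts on two neighbouring entries.
  State : Set
  State = List (A × ℕ)

  chips : State → List A
  chips = map proj₁

  sites : State → List ℕ
  sites = map proj₂

  At : Config n → State → Set
  At C = All (λ (k , s) → lookup C k ≡ + s)

  -- The firing site is `suc s`, so the site to its left is still a natural number.
  data Step : State → State → Set where
    fire : ∀ {a b s W} → Step ((a , suc s) ∷ (b , suc s) ∷ W) ((lo a b , s) ∷ (hi a b , suc (suc s)) ∷ W)
    there : ∀ {x W W′} → Step W W′ → Step (x ∷ W) (x ∷ W′)

  number : List A → ℕ → State
  number [] t = []
  number (k ∷ ks) t = (k , t) ∷ number ks (suc t)

  -- zs occupies the sites t+1, t+2, …, and xs starts on the last of them.
  layout : List A → List A → ℕ → State
  layout [] xs t = number xs t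
  layout (z ∷ zs) xs t = (z , suc t) ∷ layout zs xs (suc t)

  -- vs starts on site t; one site is left empty between vs and R.
  gapped : List A → List A → ℕ → State
  gapped [] R t = number R (suc t)
  gapped (v ∷ vs) R t = (v , t) ∷ gapped vs R (suc t)

  number-gapped : ∀ xs t → number xs t ≡ gapped xs [] t
  number-gapped [] t = refl
  number-gapped (x ∷ xs) t = cong ((x , t) ∷_) (number-gapped xs (suc t))

  -- Each toppling leaves the smaller chip one site to the left and sends the larger one onto the
  -- next chip: the row and the gap move left by one. With no chip left to pass, the swept chip
  -- already stands in the old gap.
  sweep-steps : ∀ z vs R t → let (ws , h) = sweep z vs in
    Star Step ((z , suc t) ∷ gapped vs R (suc t)) (gapped ws (h ∷ R) t)
  sweep-steps z [] R t = ε
  sweep-steps z (v ∷ vs) R t = fire ◅ Star.gmap ((lo z v , t) ∷_) there (sweep-steps (hi z v) vs R (suc t))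

  run-steps : ∀ zs xs t → let (vs , R) = run zs xs in Star Step (layout zs xs t) (gapped vs R t)
  run-steps [] xs t rewrite number-gapped xs t = ε
  run-steps (z ∷ zs) xs t = let (vs , R) = run zs xs in
    Star.gmap ((z , suc t) ∷_) there (run-steps zs xs (suc t)) ◅◅ sweep-steps z vs R t

  chips-number : ∀ ks t → chips (number ks t) ≡ ks
  chips-number [] t = refl
  chips-number (k ∷ ks) t = cong (k ∷_) (chips-number ks (suc t))

  chips-layout : ∀ zs xs t → chips (layout zs xs t) ≡ zs ++ xs
  chips-layout [] xs t = chips-number xs t
  chips-layout (z ∷ zs) xs t = cong (z ∷_) (chips-layout zs xs (suc t))

  chips-gapped : ∀ vs R t → chips (gapped vs R t) ≡ vs ++ R
  chips-gapped [] R t = chips-number R (suc t)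
  chips-gapped (v ∷ vs) R t = cong (v ∷_) (chips-gapped vs R (suc t))

  number-≥ : ∀ ks t → All (λ (k , s) → t ≤ s) (number ks t)
  number-≥ [] t = []
  number-≥ (k ∷ ks) t = ℕ.≤-refl ∷ All.map ℕ.<⇒≤ (number-≥ ks (suc t))

  gapped-≥ : ∀ vs R t → All (λ (k , s) → t ≤ s) (gapped vs R t)
  gapped-≥ [] R t = All.map ℕ.<⇒≤ (number-≥ R (suc t))
  gapped-≥ (v ∷ vs) R t = ℕ.≤-refl ∷ All.map ℕ.<⇒≤ (gapped-≥ vs R (suc t))

  Step-chips : ∀ {W W′} → Step W W′ → chips W′ ↭ chips W
  Step-chips fire = lo-hi-↭ _ _ _
  Step-chips (there st) = prep _ (Step-chips st)

  module _ (C : Config n) {α β : A} (α<β : α Fin.< β) where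
    toppled : Config n
    toppled = (C [ α ]≔ (lookup C α ℤ.- + 1)) [ β ]≔ (lookup C β ℤ.+ + 1)

    lookup-toppled-α : lookup toppled α ≡ lookup C α ℤ.- + 1
    lookup-toppled-α = trans (Vec.lookup∘update′ (Fin.<⇒≢ α<β) (C [ α ]≔ _) _) (Vec.lookup∘update α C _)

    lookup-toppled-β : lookup toppled β ≡ lookup C β ℤ.+ + 1
    lookup-toppled-β = Vec.lookup∘update β (C [ α ]≔ _) _

    lookup-toppled-other : ∀ {k} → k ≢ α → k ≢ β → lookup toppled k ≡ lookup C k
    lookup-toppled-other k≢α k≢β = trans (Vec.lookup∘update′ k≢β (C [ α ]≔ _) _) (Vec.lookup∘update′ k≢α C _)

    topple-at : ∀ {s W} → lookup C α ≡ + suc s → lookup C β ≡ + suc s → At C W → All (α ≢_) (chips W) → All (β ≢_) (chips W) →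
      Topple C toppled × At toppled ((α , s) ∷ (β , suc (suc s)) ∷ W)
    topple-at {s} Cα Cβ at α∉ β∉ = topple C α β α<β (trans Cα (sym Cβ)) ,
      (trans lookup-toppled-α (cong (ℤ._- + 1) Cα)
        ∷ trans lookup-toppled-β (trans (cong (ℤ._+ + 1) Cβ) (cong +_ (ℕ.+-comm (suc s) 1)))
        ∷ All.zipWith (λ { (Ck , α≢k , β≢k) → trans (lookup-toppled-other (α≢k ∘ sym) (β≢k ∘ sym)) Ck })
            (at , All.zip (All.map⁻ α∉ , All.map⁻ β∉)))

  -- The last component is a frame condition: a step in the tail of the state does not move the
  -- chips listed before it.
  simulate : ∀ {C W W′} → Step W W′ → At C W → Unique (chips W) →
    ∃[ D ] (Topple C D × At D W′ × (∀ {k} → All (k ≢_) (chips W) → lookup D k ≡ lookup C k))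
  simulate {C} (fire {a} {b}) (Ca ∷ Cb ∷ at) ((a≢b ∷ a∉) ∷ (b∉ ∷ u)) with a Fin.<? b
  ... | yes a<b rewrite lo-< a<b | hi-< a<b = let (t , at′) = topple-at C a<b Ca Cb at a∉ b∉ in
    _ , t , at′ , λ { (k≢a ∷ k≢b ∷ _) → lookup-toppled-other C a<b k≢a k≢b }
  ... | no a≮b rewrite lo-≮ a≮b | hi-≮ a≮b = let (t , at′) = topple-at C b<a Cb Ca at b∉ a∉ in
    _ , t , at′ , λ { (k≢a ∷ k≢b ∷ _) → lookup-toppled-other C b<a k≢b k≢a }
    where
    b<a : b Fin.< a
    b<a = ℕ.≤∧≢⇒< (ℕ.≮⇒≥ a≮b) (λ eq → a≢b (sym (Fin.toℕ-injective eq)))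
  simulate {C} (there st) (Ck ∷ at) (k∉ ∷ u) with simulate {C} st at u
  ... | D , t , at′ , frame = D , t , trans (frame k∉) Ck ∷ at′ , λ { (_ ∷ ∉) → frame ∉ }

  simulate* : ∀ {C W W′} → Star Step W W′ → At C W → Unique (chips W) → ∃[ D ] (Star Topple C D × At D W′)
  simulate* {C} ε at u = C , ε , at
  simulate* {C} (st ◅ sts) at u with simulate {C} st at u
  ... | D , t , at′ , _ = map₂ (map₁ (t ◅_)) (simulate* {D} sts at′ (Unique-resp-↭ (↭-sym (Step-chips st)) u))

  At-map : ∀ {C} W → At C W → map (lookup C) (chips W) ≡ map +_ (sites W)
  At-map [] [] = refl
  At-map {C} (_ ∷ W) (e ∷ at) = cong₂ _∷_ e (At-map {C} W at)

  map-At : ∀ {C} W → map (lookup C) (chips W) ≡ map +_ (sites W) → At C W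
  map-At [] eq = []
  map-At {C} (_ ∷ W) eq = List.∷-injectiveˡ eq ∷ map-At {C} W (List.∷-injectiveʳ eq)

  -- Site 0 is a default that a state listing every chip overwrites.
  place : State → Config n
  place [] = Vec.replicate n (+ 0)
  place ((k , s) ∷ W) = place W [ k ]≔ + s

  At-place : ∀ W → Unique (chips W) → At (place W) W
  At-place [] u = []
  At-place ((k , s) ∷ W) (k∉ ∷ u) = Vec.lookup∘update k (place W) (+ s) ∷
    All.zipWith (λ (k≢l , e) → trans (Vec.lookup∘update′ (k≢l ∘ sym) (place W) (+ s)) e) (All.map⁻ k∉ , At-place W u)

  lookup-ext : ∀ {m} {X : Set} {xs ys : Vec X m} → (∀ k → lookup xs k ≡ lookup ys k) → xs ≡ ys
  lookup-ext {xs = xs} {ys} eq = trans (sym (Vec.tabulate∘lookup xs)) (trans (Vec.tabulate-cong eq) (Vec.tabulate∘lookup ys))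

  At-unique : ∀ {C D W} → At C W → At D W → chips W ↭ allFin n → C ≡ D
  At-unique {C} {D} {W} atC atD p = lookup-ext same
    where
    same : ∀ k → lookup C k ≡ lookup D k
    same k with ∈-map⁻ proj₁ (∈-resp-↭ (↭-sym p) (∈-allFin k))
    ... | x , x∈ , refl = trans (All.lookup atC x∈) (sym (All.lookup atD x∈))

  -- If the heads differed, each would come after the other in one of the lists, against asymmetry.
  sorted-unique : ∀ {R : A → A → Set} → (∀ {k l} → R k l → ¬ R l k) → ∀ {xs ys} → AllPairs R xs → AllPairs R ys → xs ↭ ys → xs ≡ ys
  sorted-unique asym {[]} [] _ p = sym (↭-empty-inv (↭-sym p))
  sorted-unique asym {x ∷ xs} {[]} _ _ p with ↭-length p
  ... | ()
  sorted-unique asym {x ∷ xs} {y ∷ ys} (x< ∷ s) (y< ∷ s′) p with ∈-resp-↭ p (here refl) | ∈-resp-↭ (↭-sym p) (here refl)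
  ... | here refl | _ = cong (x ∷_) (sorted-unique asym s s′ (drop-∷ p))
  ... | _ | here refl = cong (x ∷_) (sorted-unique asym s s′ (drop-∷ p))
  ... | there x∈ | there y∈ = ⊥-elim (asym (All.lookup x< y∈) (All.lookup y< x∈))

  gapped-sorted : ∀ {C} vs R t → At C (gapped vs R t) → AllPairs (λ k l → lookup C k ℤ.< lookup C l) (vs ++ R)
  gapped-sorted {C} vs R t at = subst (AllPairs _) (chips-gapped vs R t) (AllPairs.map⁺ (sorted at (increasing vs t)))
    where
    increasing-number : ∀ ks t → AllPairs (λ x y → proj₂ x < proj₂ y) (number ks t)
    increasing-number [] t = []
    increasing-number (k ∷ ks) t = number-≥ ks (suc t) ∷ increasing-number ks (suc t)
    increasing : ∀ vs t → AllPairs (λ x y → proj₂ x < proj₂ y) (gapped vs R t)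
    increasing [] t = increasing-number R (suc t)
    increasing (v ∷ vs) t = gapped-≥ vs R (suc t) ∷ increasing vs (suc t)
    sorted : ∀ {W} → At C W → AllPairs (λ x y → proj₂ x < proj₂ y) W → AllPairs (λ x y → lookup C (proj₁ x) ℤ.< lookup C (proj₁ y)) W
    sorted [] [] = []
    sorted (e ∷ at) (s< ∷ inc) = All.zipWith (λ (e′ , s<s′) → subst₂ ℤ._<_ (sym e) (sym e′) (ℤ.+<+ s<s′)) (at , s<) ∷ sorted at inc

  -- Sites alone leave a tie on the shared site; `Ascending` breaks it by label, which makes the
  -- word a function of the configuration.
  layout-sorted : ∀ {C zs xs} t → Ascending zs xs → At C (layout zs xs t) →
    AllPairs (λ k l → lookup C k ℤ.< lookup C l ⊎ (lookup C k ≡ lookup C l × k Fin.< l)) (zs ++ xs)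
  layout-sorted {C} {zs} {xs} t asc at = subst (AllPairs _) (chips-layout zs xs t) (AllPairs.map⁺ (sorted asc at))
    where
    R : A × ℕ → A × ℕ → Set
    R x y = lookup C (proj₁ x) ℤ.< lookup C (proj₁ y) ⊎ (lookup C (proj₁ x) ≡ lookup C (proj₁ y) × proj₁ x Fin.< proj₁ y)
    layout-> : ∀ {zs xs t} → Ascending zs xs → All (λ (k , s) → t < s) (layout zs xs t)
    layout-> {xs = xs} {t} (meet _) = ℕ.≤-refl ∷ number-≥ xs (suc t)
    layout-> (skip asc) = ℕ.≤-refl ∷ All.map ℕ.<⇒≤ (layout-> asc)
    below : ∀ {x W} → lookup C (proj₁ x) ≡ + proj₂ x → At C W → All (λ y → proj₂ x < proj₂ y) W → All (R x) W
    below e at s< = All.zipWith (λ (e′ , s<s′) → inj₁ (subst₂ ℤ._<_ (sym e) (sym e′) (ℤ.+<+ s<s′))) (at , s<)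
    sorted-number : ∀ ks t → At C (number ks t) → AllPairs R (number ks t)
    sorted-number [] t [] = []
    sorted-number (k ∷ ks) t (e ∷ at) = below e at (number-≥ ks (suc t)) ∷ sorted-number ks (suc t) at
    sorted : ∀ {zs xs t} → Ascending zs xs → At C (layout zs xs t) → AllPairs R (layout zs xs t)
    sorted {xs = x ∷ xs} {t} (meet z<x) (e ∷ at@(e′ ∷ at′)) =
      (inj₂ (trans e (sym e′) , z<x) ∷ below e at′ (number-≥ xs (suc (suc t)))) ∷ sorted-number (x ∷ xs) (suc t) at
    sorted (skip asc) (e ∷ at) = below e at (layout-> asc) ∷ sorted asc at

  layout-unique : ∀ {C zs xs zs′ xs′} → Ascending zs xs → Ascending zs′ xs′ → At C (layout zs xs 0) → At C (layout zs′ xs′ 0) →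
    zs ++ xs ↭ zs′ ++ xs′ → zs ++ xs ≡ zs′ ++ xs′
  layout-unique {C} asc asc′ at at′ = sorted-unique asym (layout-sorted {C} 0 asc at) (layout-sorted {C} 0 asc′ at′)
    where
    asym : ∀ {k l} → lookup C k ℤ.< lookup C l ⊎ (lookup C k ≡ lookup C l × k Fin.< l) → ¬ (lookup C l ℤ.< lookup C k ⊎ (lookup C l ≡ lookup C k × l Fin.< k))
    asym (inj₁ p) (inj₁ q) = ℤ.<-asym p q
    asym (inj₁ p) (inj₂ (e , _)) = ℤ.<-irrefl (sym e) p
    asym (inj₂ (e , _)) (inj₁ q) = ℤ.<-irrefl (sym e) q
    asym (inj₂ (_ , p)) (inj₂ (_ , q)) = ℕ.<-asym p q

  ascend : ∀ {C} z zs x xs t → Unique (z ∷ zs ++ x ∷ xs) → At C (layout (z ∷ zs) (x ∷ xs) t) → ∃[ zs′ ] ∃[ xs′ ]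
    (Ascending zs′ xs′ × length zs′ ≡ suc (length zs) × zs′ ++ xs′ ↭ z ∷ zs ++ x ∷ xs × At C (layout zs′ xs′ t))
  ascend z [] x xs t ((z≢x ∷ _) ∷ _) at@(Cz ∷ Cx ∷ at′) with z Fin.<? x
  ... | yes z<x = z ∷ [] , x ∷ xs , meet z<x , refl , ↭-refl , at
  ... | no z≮x = x ∷ [] , z ∷ xs , meet (ℕ.≤∧≢⇒< (ℕ.≮⇒≥ z≮x) (λ eq → z≢x (sym (Fin.toℕ-injective eq)))) ,
    refl , swap x z ↭-refl , (Cx ∷ Cz ∷ at′)
  ascend {C} y (z ∷ zs) x xs t (_ ∷ u) (Cy ∷ at) with ascend {C} z zs x xs (suc t) u at
  ... | zs′ , xs′ , asc , len , p , at′ = y ∷ zs′ , xs′ , skip asc , cong suc len , prep y p , Cy ∷ at′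

  ReadsAs⇒AllPairs : ∀ {D : Config n} {π : Perm n} → ReadsAs D π → AllPairs (λ k l → lookup D k ℤ.< lookup D l) (toList π)
  ReadsAs⇒AllPairs = go _
    where
    go : ∀ {m} {R : A → A → Set} (ks : Vec A m) → (∀ i j → i Fin.< j → R (lookup ks i) (lookup ks j)) → AllPairs R (toList ks)
    go [] r = []
    go {R = R} (k ∷ ks) r = All.tabulate (λ l∈ → let (i , e) = ∈-toList⁻ l∈ in subst (R k) e (r Fin.zero (Fin.suc i) z<s)) ∷
        go ks (λ i j i<j → r (Fin.suc i) (Fin.suc j) (s<s i<j))

  AllPairs⇒ReadsAs : ∀ {D : Config n} {π : Perm n} → AllPairs (λ k l → lookup D k ℤ.< lookup D l) (toList π) → ReadsAs D π
  AllPairs⇒ReadsAs = go _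
    where
    All-lookup : ∀ {m} {P : A → Set} (ks : Vec A m) → All P (toList ks) → ∀ i → P (lookup ks i)
    All-lookup (k ∷ ks) (p ∷ _) Fin.zero = p
    All-lookup (k ∷ ks) (_ ∷ ps) (Fin.suc i) = All-lookup ks ps i
    go : ∀ {m} {R : A → A → Set} (ks : Vec A m) → AllPairs R (toList ks) → ∀ i j → i Fin.< j → R (lookup ks i) (lookup ks j)
    go (k ∷ ks) (r ∷ rs) Fin.zero (Fin.suc j) _ = All-lookup ks r j
    go (k ∷ ks) (r ∷ rs) (Fin.suc i) (Fin.suc j) i<j = go ks rs i j (ℕ.s<s⁻¹ i<j)

  IsPerm⇒Unique : ∀ {π : Perm n} → IsPerm π → Unique (toList π)
  IsPerm⇒Unique {π} inj = subst Unique (toList-tabulate π) (Unique.tabulate⁺ inj)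
    where
    toList-tabulate : ∀ {m} (ks : Vec A m) → Data.List.tabulate (lookup ks) ≡ toList ks
    toList-tabulate [] = refl
    toList-tabulate (k ∷ ks) = cong (k ∷_) (toList-tabulate ks)

  Unique⇒↭ : ∀ {X : Set} {xs ys : List X} → Unique xs → (∀ {x} → x ∈ xs → x ∈ ys) → length ys ≤ length xs → xs ↭ ys
  Unique⇒↭ {xs = []} {[]} _ _ _ = ↭-refl
  Unique⇒↭ {xs = x ∷ xs} {ys} (x∉ ∷ u) sub len with ∈-∃++ (sub (here refl))
  ... | as , bs , refl = ↭-trans (prep x (Unique⇒↭ u sub′ (ℕ.s≤s⁻¹ (subst (_≤ suc (length xs)) (↭-length (shift x as bs)) len)))) (↭-sym (shift x as bs))
    where
    sub′ : ∀ {y} → y ∈ xs → y ∈ as ++ bs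
    sub′ y∈ with ∈-resp-↭ (shift x as bs) (sub (there y∈))
    ... | here refl = ⊥-elim (All.lookup x∉ y∈ refl)
    ... | there y∈′ = y∈′

  IsPerm⇒↭ : ∀ {π : Perm n} → IsPerm π → toList π ↭ allFin n
  IsPerm⇒↭ {π} inj = Unique⇒↭ (IsPerm⇒Unique {π} inj) (λ {k} _ → ∈-allFin k)
    (ℕ.≤-reflexive (trans (List.length-tabulate id) (sym (Vec.length-toList π))))

  sorted⇒Stable : ∀ {D : Config n} {ks} → ks ↭ allFin n → AllPairs (λ k l → lookup D k ℤ.< lookup D l) ks → Stable D
  sorted⇒Stable {D} p sorted {k} {l} eq with compare sorted (∈-resp-↭ (↭-sym p) (∈-allFin k)) (∈-resp-↭ (↭-sym p) (∈-allFin l))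
    where
    compare : ∀ {R : A → A → Set} {ks k l} → AllPairs R ks → k ∈ ks → l ∈ ks → k ≡ l ⊎ R k l ⊎ R l k
    compare (r ∷ rs) (here refl) (here refl) = inj₁ refl
    compare (r ∷ rs) (here refl) (there l∈) = inj₂ (inj₁ (All.lookup r l∈))
    compare (r ∷ rs) (there k∈) (here refl) = inj₂ (inj₂ (All.lookup r k∈))
    compare (r ∷ rs) (there k∈) (there l∈) = compare rs k∈ l∈
  ... | inj₁ k≡l = k≡l
  ... | inj₂ (inj₁ k<l) = ⊥-elim (ℤ.<-irrefl eq k<l)
  ... | inj₂ (inj₂ l<k) = ⊥-elim (ℤ.<-irrefl (sym eq) l<k)

-- Cumulative chip counts and confluence.

total-↭ : ∀ {X : Set} {xs ys : List X} (g : X → ℕ) → xs ↭ ys → total xs g ≡ total ys g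
total-↭ g _↭_.refl = refl
total-↭ g (prep x p) = cong (g x ℕ.+_) (total-↭ g p)
total-↭ g (swap x y p) = trans (sym (ℕ.+-assoc (g x) (g y) _)) (trans (cong₂ _+_ (ℕ.+-comm (g x) (g y)) (total-↭ g p)) (ℕ.+-assoc (g y) (g x) _))
total-↭ g (_↭_.trans p q) = trans (total-↭ g p) (total-↭ g q)

total-≤ : ∀ {X : Set} (xs : List X) {f g : X → ℕ} → (∀ x → f x ≤ g x) → total xs f ≤ total xs g
total-≤ [] le = z≤n
total-≤ (x ∷ xs) le = ℕ.+-mono-≤ (le x) (total-≤ xs le)

total-< : ∀ {X : Set} {m} (xs : Vec X m) i {f g : X → ℕ} → (∀ x → f x ≤ g x) → f (lookup xs i) < g (lookup xs i) → total (toList xs) f < total (toList xs) g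
total-< (x ∷ xs) Fin.zero le lt = ℕ.+-mono-<-≤ lt (total-≤ (toList xs) le)
total-< (x ∷ xs) (Fin.suc i) le lt = ℕ.+-mono-≤-< (le x) (total-< xs i le lt)

-- The old value is added back on the left, which avoids truncated subtraction.
total-update : ∀ {X : Set} {m} (xs : Vec X m) i y (g : X → ℕ) →
  total (toList (xs [ i ]≔ y)) g + g (lookup xs i) ≡ total (toList xs) g + g y
total-update (x ∷ xs) Fin.zero y g = solve 3 (λ a b c → (a :+ b) :+ c := (c :+ b) :+ a) refl (g y) (total (toList xs) g) (g x)
total-update (x ∷ xs) (Fin.suc i) y g = trans (ℕ.+-assoc (g x) _ _) (trans (cong (g x ℕ.+_) (total-update xs i y g)) (sym (ℕ.+-assoc (g x) _ _)))

⟦_⊑_⟧ : ℤ → ℤ → ℕ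
⟦ x ⊑ s ⟧ = 1 when (x ℤ.≤? s)

below : ∀ {m} → ℤ → Config m → ℕ
below s C = total (toList C) ⟦_⊑ s ⟧

⊑-yes : ∀ {x s} → x ℤ.≤ s → ⟦ x ⊑ s ⟧ ≡ 1
⊑-yes {x} {s} x≤s = when-true (x ℤ.≤? s) x≤s

⊑-no : ∀ {x s} → s ℤ.< x → ⟦ x ⊑ s ⟧ ≡ 0
⊑-no {x} {s} s<x = when-false (x ℤ.≤? s) (ℤ.<⇒≱ s<x)

⊑-mono : ∀ {s t} → s ℤ.≤ t → ∀ x → ⟦ x ⊑ s ⟧ ≤ ⟦ x ⊑ t ⟧
⊑-mono {s} {t} s≤t x with x ℤ.≤? s
... | yes x≤s = ℕ.≤-reflexive (sym (⊑-yes (ℤ.≤-trans x≤s s≤t)))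
... | no _ = z≤n

m-1<m : ∀ s → s ℤ.- + 1 ℤ.< s
m-1<m s = ℤ.<-≤-trans (ℤ.+-monoʳ-< s (ℤ.-<+ {0} {0})) (ℤ.≤-reflexive (ℤ.+-identityʳ s))

m<m+1 : ∀ s → s ℤ.< s ℤ.+ + 1
m<m+1 s = ℤ.≤-<-trans (ℤ.≤-reflexive (sym (ℤ.+-identityʳ s))) (ℤ.+-monoʳ-< s (ℤ.+<+ (s≤s z≤n)))

m<n⇒m≤n-1 : ∀ {m n} → m ℤ.< n → m ℤ.≤ n ℤ.- + 1
m<n⇒m≤n-1 {m} {n} m<n = subst (m ℤ.≤_) (ℤ.+-comm (ℤ.- + 1) n) (ℤ.i<j⇒i≤pred[j] m<n)

m<n⇒m+1≤n : ∀ {m n} → m ℤ.< n → m ℤ.+ + 1 ℤ.≤ n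
m<n⇒m+1≤n {m} {n} m<n = subst (ℤ._≤ n) (ℤ.+-comm (+ 1) m) (ℤ.i<j⇒suc[i]≤j m<n)

-- For base = clamp, base s counts the sites 1, …, n-1 up to s.  A site with two chips is one where the excess
-- of `below` over base rises from 0 to 1, so a third chip on the same site is impossible.
module Confluence {m : ℕ} (base : ℤ → ℕ) (base-step : ∀ s → base s ≤ suc (base (s ℤ.- + 1))) where

  Inv : Config m → Set
  Inv C = ∀ s → base s ≤ below s C × below s C ≤ suc (base s)

  module _ (C : Config m) {α β : Fin m} (α<β : α Fin.< β) (eq : lookup C α ≡ lookup C β) where
    private
      s = lookup C α
      D = toppled C α<β

    below-toppled : ∀ t → below t D + ⟦ s ⊑ t ⟧ + ⟦ s ⊑ t ⟧ ≡ below t C + ⟦ s ℤ.- + 1 ⊑ t ⟧ + ⟦ s ℤ.+ + 1 ⊑ t ⟧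
    below-toppled t = begin
      below t D + ⟦ s ⊑ t ⟧ + ⟦ s ⊑ t ⟧
        ≡⟨ cong (λ x → below t D + ⟦ x ⊑ t ⟧ + ⟦ s ⊑ t ⟧) (trans eq (sym (Vec.lookup∘update′ (Fin.<⇒≢ α<β ∘ sym) C _))) ⟩
      below t D + ⟦ lookup C′ β ⊑ t ⟧ + ⟦ s ⊑ t ⟧
        ≡⟨ cong (_+ ⟦ s ⊑ t ⟧) (total-update C′ β (lookup C β ℤ.+ + 1) ⟦_⊑ t ⟧) ⟩
      below t C′ + ⟦ lookup C β ℤ.+ + 1 ⊑ t ⟧ + ⟦ s ⊑ t ⟧
        ≡⟨ cong (λ x → below t C′ + ⟦ x ℤ.+ + 1 ⊑ t ⟧ + ⟦ s ⊑ t ⟧) (sym eq) ⟩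
      below t C′ + ⟦ s ℤ.+ + 1 ⊑ t ⟧ + ⟦ s ⊑ t ⟧
        ≡⟨ solve 3 (λ a b c → a :+ b :+ c := a :+ c :+ b) refl (below t C′) ⟦ s ℤ.+ + 1 ⊑ t ⟧ ⟦ s ⊑ t ⟧ ⟩
      below t C′ + ⟦ s ⊑ t ⟧ + ⟦ s ℤ.+ + 1 ⊑ t ⟧
        ≡⟨ cong (_+ ⟦ s ℤ.+ + 1 ⊑ t ⟧) (total-update C α (s ℤ.- + 1) ⟦_⊑ t ⟧) ⟩
      below t C + ⟦ s ℤ.- + 1 ⊑ t ⟧ + ⟦ s ℤ.+ + 1 ⊑ t ⟧ ∎
      where
      open ≡-Reasoning
      C′ = C [ α ]≔ (s ℤ.- + 1)

    private
      shift-by : ∀ t {a b c} → ⟦ s ⊑ t ⟧ ≡ a → ⟦ s ℤ.- + 1 ⊑ t ⟧ ≡ b → ⟦ s ℤ.+ + 1 ⊑ t ⟧ ≡ c →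
        below t D + a + a ≡ below t C + b + c
      shift-by t refl refl refl = below-toppled t

    below-at : suc (below s D) ≡ below s C
    below-at = ℕ.suc-injective (trans (solve 1 (λ x → con 1 :+ (con 1 :+ x) := x :+ con 1 :+ con 1) refl (below s D))
      (trans (shift-by s (⊑-yes (ℤ.≤-refl {s})) (⊑-yes (ℤ.<⇒≤ (m-1<m s))) (⊑-no (m<m+1 s)))
        (solve 1 (λ x → x :+ con 1 :+ con 0 := con 1 :+ x) refl (below s C))))

    below-pred : below (s ℤ.- + 1) D ≡ suc (below (s ℤ.- + 1) C)
    below-pred = trans (solve 1 (λ x → x := x :+ con 0 :+ con 0) refl (below (s ℤ.- + 1) D))
      (trans (shift-by (s ℤ.- + 1) (⊑-no (m-1<m s)) (⊑-yes (ℤ.≤-refl {s ℤ.- + 1})) (⊑-no (ℤ.<-trans (m-1<m s) (m<m+1 s))))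
        (solve 1 (λ x → x :+ con 1 :+ con 0 := con 1 :+ x) refl (below (s ℤ.- + 1) C)))

    below-other : ∀ {t} → t ≢ s → t ≢ s ℤ.- + 1 → below t D ≡ below t C
    below-other {t} t≢s t≢s-1 with ℤ.<-cmp t s
    ... | tri≈ _ t≡s _ = ⊥-elim (t≢s t≡s)
    ... | tri< t<s _ _ = trans (solve 1 (λ x → x := x :+ con 0 :+ con 0) refl (below t D))
      (trans (shift-by t (⊑-no t<s) (⊑-no (ℤ.≤∧≢⇒< (m<n⇒m≤n-1 t<s) t≢s-1)) (⊑-no (ℤ.<-trans t<s (m<m+1 s))))
        (solve 1 (λ x → x :+ con 0 :+ con 0 := x) refl (below t C)))
    ... | tri> _ _ s<t = ℕ.suc-injective (ℕ.suc-injective (trans (solve 1 (λ x → con 1 :+ (con 1 :+ x) := x :+ con 1 :+ con 1) refl (below t D))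
      (trans (shift-by t (⊑-yes (ℤ.<⇒≤ s<t)) (⊑-yes (ℤ.<⇒≤ (ℤ.<-trans (m-1<m s) s<t))) (⊑-yes (m<n⇒m+1≤n s<t)))
        (solve 1 (λ x → x :+ con 1 :+ con 1 := con 1 :+ (con 1 :+ x)) refl (below t C)))))

    -- Monotonicity of the cumulative count is applied after the toppling, which has raised the
    -- count at s - 1 by one and lowered that at s by one.
    two-below : suc (suc (below (s ℤ.- + 1) C)) ≤ below s C
    two-below = subst₂ _≤_ (cong suc below-pred) below-at
      (s≤s (total-≤ (toList D) (⊑-mono (ℤ.<⇒≤ (m-1<m s)))))

    -- Two chips on s force the count to its lower bound at s - 1 and to its upper bound at s, so
    -- both have room for the change.
    Inv-toppled : Inv C → Inv D
    Inv-toppled inv t with t ℤ.≟ s | t ℤ.≟ s ℤ.- + 1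
    ... | yes refl | _ =
      ℕ.≤-trans (base-step s) (ℕ.≤-trans (s≤s (proj₁ (inv (s ℤ.- + 1)))) (ℕ.s≤s⁻¹ (ℕ.≤-trans two-below (ℕ.≤-reflexive (sym below-at))))) ,
      ℕ.≤-trans (ℕ.n≤1+n _) (ℕ.≤-trans (ℕ.≤-reflexive below-at) (proj₂ (inv s)))
    ... | no _ | yes refl =
      ℕ.≤-trans (proj₁ (inv t)) (ℕ.≤-trans (ℕ.n≤1+n _) (ℕ.≤-reflexive (sym below-pred))) ,
      ℕ.≤-trans (ℕ.≤-reflexive below-pred) (ℕ.s≤s⁻¹ (ℕ.≤-trans two-below (ℕ.≤-trans (proj₂ (inv s)) (s≤s (base-step s)))))
    ... | no t≢s | no t≢s-1 = subst (λ b → base t ≤ b × b ≤ suc (base t)) (sym (below-other t≢s t≢s-1)) (inv t)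

    -- A chip still on s would separate the counts at s - 1 and s, but the bounds leave no room
    -- between them after the toppling.
    vacated : Inv C → ∀ k → lookup D k ≢ s
    vacated inv k eq = ℕ.<⇒≱ (total-< D k (⊑-mono (ℤ.<⇒≤ (m-1<m s)))
        (subst₂ _<_ (sym (⊑-no (subst (s ℤ.- + 1 ℤ.<_) (sym eq) (m-1<m s)))) (sym (⊑-yes (ℤ.≤-reflexive eq))) (s≤s z≤n)))
      (begin
        below s D ≤⟨ ℕ.s≤s⁻¹ (ℕ.≤-trans (ℕ.≤-reflexive below-at) (proj₂ (inv s))) ⟩
        base s ≤⟨ base-step s ⟩
        suc (base (s ℤ.- + 1)) ≤⟨ s≤s (proj₁ (inv (s ℤ.- + 1))) ⟩
        suc (below (s ℤ.- + 1) C) ≡⟨ below-pred ⟨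
        below (s ℤ.- + 1) D ∎)
      where open ℕ.≤-Reasoning

  Inv-Topple : ∀ {C D : Config m} → Topple C D → Inv C → Inv D
  Inv-Topple (topple C α β α<β eq) = Inv-toppled C α<β eq

  -- On one site the pair is forced, since no third chip is there; on two sites the four chips are
  -- distinct and the updates commute.
  diamond : ∀ {C D₁ D₂ : Config m} → Inv C → Topple C D₁ → Topple C D₂ → D₁ ≡ D₂ ⊎ ∃[ E ] (Topple D₁ E × Topple D₂ E)
  diamond inv (topple C α β α<β eq) (topple _ α′ β′ α′<β′ eq′) with lookup C α ℤ.≟ lookup C α′
  ... | yes same with chip α′ (sym same) | chip β′ (sym (trans same eq′))
    where
    chip : ∀ k → lookup C k ≡ lookup C α → k ≡ α ⊎ k ≡ β
    chip k e with k Fin.≟ α | k Fin.≟ β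
    ... | yes k≡α | _ = inj₁ k≡α
    ... | no _ | yes k≡β = inj₂ k≡β
    ... | no k≢α | no k≢β = ⊥-elim (vacated C α<β eq inv k (trans (lookup-toppled-other C α<β k≢α k≢β) e))
  ...   | inj₁ refl | inj₂ refl = inj₁ refl
  ...   | inj₁ refl | inj₁ refl = ⊥-elim (ℕ.<-irrefl refl α′<β′)
  ...   | inj₂ refl | inj₂ refl = ⊥-elim (ℕ.<-irrefl refl α′<β′)
  ...   | inj₂ refl | inj₁ refl = ⊥-elim (ℕ.<-asym α<β α′<β′)
  diamond inv (topple C α β α<β eq) (topple _ α′ β′ α′<β′ eq′) | no differ = inj₂ (_ ,
    subst (Topple D₁) E₁≡ (topple D₁ α′ β′ α′<β′ (trans D₁α′ (trans eq′ (sym D₁β′)))) ,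
    subst (Topple D₂) E₂≡ (topple D₂ α β α<β (trans D₂α (trans eq (sym D₂β)))))
    where
    D₁ = toppled C α<β
    D₂ = toppled C α′<β′
    a = lookup C α ℤ.- + 1
    b = lookup C β ℤ.+ + 1
    a′ = lookup C α′ ℤ.- + 1
    b′ = lookup C β′ ℤ.+ + 1
    α≢α′ : α ≢ α′
    α≢α′ refl = differ refl
    α≢β′ : α ≢ β′
    α≢β′ refl = differ (sym eq′)
    β≢α′ : β ≢ α′
    β≢α′ refl = differ eq
    β≢β′ : β ≢ β′
    β≢β′ refl = differ (trans eq (sym eq′))
    D₁α′ = lookup-toppled-other C α<β (α≢α′ ∘ sym) (β≢α′ ∘ sym)
    D₁β′ = lookup-toppled-other C α<β (α≢β′ ∘ sym) (β≢β′ ∘ sym)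
    D₂α = lookup-toppled-other C α′<β′ α≢α′ α≢β′
    D₂β = lookup-toppled-other C α′<β′ β≢α′ β≢β′
    E₁≡ : (D₁ [ α′ ]≔ (lookup D₁ α′ ℤ.- + 1)) [ β′ ]≔ (lookup D₁ β′ ℤ.+ + 1) ≡ (D₁ [ α′ ]≔ a′) [ β′ ]≔ b′
    E₁≡ = cong₂ (λ x y → (D₁ [ α′ ]≔ (x ℤ.- + 1)) [ β′ ]≔ (y ℤ.+ + 1)) D₁α′ D₁β′
    E₂≡ : (D₂ [ α ]≔ (lookup D₂ α ℤ.- + 1)) [ β ]≔ (lookup D₂ β ℤ.+ + 1) ≡ (D₁ [ α′ ]≔ a′) [ β′ ]≔ b′
    E₂≡ = begin
      (D₂ [ α ]≔ (lookup D₂ α ℤ.- + 1)) [ β ]≔ (lookup D₂ β ℤ.+ + 1)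
        ≡⟨ cong₂ (λ x y → (D₂ [ α ]≔ (x ℤ.- + 1)) [ β ]≔ (y ℤ.+ + 1)) D₂α D₂β ⟩
      (((C [ α′ ]≔ a′) [ β′ ]≔ b′) [ α ]≔ a) [ β ]≔ b ≡⟨ cong (_[ β ]≔ b) (Vec.[]≔-commutes (C [ α′ ]≔ a′) β′ α (α≢β′ ∘ sym)) ⟩
      (((C [ α′ ]≔ a′) [ α ]≔ a) [ β′ ]≔ b′) [ β ]≔ b ≡⟨ cong (λ X → (X [ β′ ]≔ b′) [ β ]≔ b) (Vec.[]≔-commutes C α′ α (α≢α′ ∘ sym)) ⟩
      (((C [ α ]≔ a) [ α′ ]≔ a′) [ β′ ]≔ b′) [ β ]≔ b ≡⟨ Vec.[]≔-commutes ((C [ α ]≔ a) [ α′ ]≔ a′) β′ β (β≢β′ ∘ sym) ⟩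
      (((C [ α ]≔ a) [ α′ ]≔ a′) [ β ]≔ b) [ β′ ]≔ b′ ≡⟨ cong (_[ β′ ]≔ b′) (Vec.[]≔-commutes (C [ α ]≔ a) α′ β (β≢α′ ∘ sym)) ⟩
      (D₁ [ α′ ]≔ a′) [ β′ ]≔ b′ ∎
      where open ≡-Reasoning

  Stable⇒¬Topple : ∀ {C D : Config m} → Stable C → ¬ Topple C D
  Stable⇒¬Topple stable (topple C α β α<β eq) = Fin.<⇒≢ α<β (stable eq)

  -- Diamonds push the toppling along the run until the run performs it itself, which must happen
  -- because a stable end admits no toppling.
  postpone : ∀ {C C₁ D} → Inv C → Topple C C₁ → Star Topple C D → Stable D → Star Topple C₁ D
  postpone inv t ε stable = ⊥-elim (Stable⇒¬Topple stable t)
  postpone inv t (t′ ◅ ts) stable with diamond inv t t′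
  ... | inj₁ refl = ts
  ... | inj₂ (E , t₁ , t₂) = t₁ ◅ postpone (Inv-Topple t′ inv) t₂ ts stable

  final-unique : ∀ {C D₁ D₂} → Inv C → Star Topple C D₁ → Stable D₁ → Star Topple C D₂ → Stable D₂ → D₁ ≡ D₂
  final-unique inv ε stable₁ ε stable₂ = refl
  final-unique inv ε stable₁ (t ◅ _) stable₂ = ⊥-elim (Stable⇒¬Topple stable₁ t)
  final-unique inv (t ◅ ts) stable₁ ts′ stable₂ = final-unique (Inv-Topple t inv) ts stable₁ (postpone inv t ts′ stable₂) stable₂

-- Initial configurations as a multiset of sites.

count : ℤ → List ℤ → ℕ
count s xs = total xs (λ x → 1 when (x ℤ.≟ s))

chipsAt-count : ∀ {m} s (C : Config m) → chipsAt s C ≡ count s (toList C)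
chipsAt-count s C = go (toList C)
  where
  go : ∀ xs → length (filter (ℤ._≟ s) xs) ≡ count s xs
  go [] = refl
  go (x ∷ xs) with x ℤ.≟ s
  ... | yes _ = cong suc (go xs)
  ... | no _ = go xs

count-∈ : ∀ {s xs} → 0 < count s xs → s ∈ xs
count-∈ {s} {x ∷ xs} pos with x ℤ.≟ s
... | yes refl = here refl
... | no _ = there (count-∈ pos)

count-↭ : ∀ xs ys → (∀ s → count s xs ≡ count s ys) → xs ↭ ys
count-↭ [] [] eq = ↭-refl
count-↭ [] (y ∷ ys) eq with trans (eq y) (cong (_+ count y ys) (when-true (y ℤ.≟ y) refl))
... | ()
count-↭ (x ∷ xs) ys eq with ∈-∃++ (count-∈ {x} {ys} (subst (0 <_) (trans (cong (_+ count x xs) (sym (when-true (x ℤ.≟ x) refl))) (eq x)) (s≤s z≤n)))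
... | as , bs , refl = ↭-trans (prep x (count-↭ xs (as ++ bs) λ s →
    ℕ.+-cancelˡ-≡ (1 when (x ℤ.≟ s)) _ _ (trans (eq s) (total-↭ _ (shift x as bs))))) (↭-sym (shift x as bs))

interval : ℕ → ℕ → List ℕ
interval zero t = []
interval (suc k) t = t ∷ interval k (suc t)

initialSites : ℕ → ℕ → ℕ → List ℕ
initialSites zero q t = interval q t
initialSites (suc p) q t = suc t ∷ initialSites p q (suc t)

total-initialSites : ∀ p q t (g : ℕ → ℕ) → total (initialSites p q t) g ≡ total (interval p (suc t)) g + total (interval q (p + t)) g
total-initialSites zero q t g = refl
total-initialSites (suc p) q t g = trans (cong (λ x → g (suc t) + x) (trans (total-initialSites p q (suc t) g)
    (cong (λ x → total (interval p (suc (suc t))) g + total (interval q x) g) (ℕ.+-suc p t))))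
  (sym (ℕ.+-assoc (g (suc t)) _ _))

total-map : ∀ {X Y : Set} (f : X → Y) xs g → total (map f xs) g ≡ total xs (g ∘ f)
total-map f [] g = refl
total-map f (x ∷ xs) g = cong (λ y → g (f x) + y) (total-map f xs g)

total-zero : ∀ {X : Set} (xs : List X) g → (∀ x → g x ≡ 0) → total xs g ≡ 0
total-zero [] g eq = refl
total-zero (x ∷ xs) g eq = cong₂ _+_ (eq x) (total-zero xs g eq)

[_at_] : ℕ → ℕ → ℕ
[ x at m ] = 1 when (+ x ℤ.≟ + m)

at-≢ : ∀ {x m} → x ≢ m → [ x at m ] ≡ 0
at-≢ x≢m = when-false (_ ℤ.≟ _) (x≢m ∘ ℤ.+-injective)

interval-< : ∀ k t m → m < t → total (interval k t) [_at m ] ≡ 0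
interval-< zero t m m<t = refl
interval-< (suc k) t m m<t = cong₂ _+_ (at-≢ (ℕ.>⇒≢ m<t)) (interval-< k (suc t) m (ℕ.m≤n⇒m≤1+n m<t))

interval-∈ : ∀ k t m → t ≤ m → m < t + k → total (interval k t) [_at m ] ≡ 1
interval-∈ zero t m t≤m m<t+k = ⊥-elim (ℕ.<⇒≱ (subst (m <_) (ℕ.+-identityʳ t) m<t+k) t≤m)
interval-∈ (suc k) t m t≤m m<t+k with t ℕ.≟ m
... | yes refl = cong₂ _+_ (when-true (+ t ℤ.≟ + t) refl) (interval-< k (suc t) t ℕ.≤-refl)
... | no t≢m = cong₂ _+_ (at-≢ t≢m) (interval-∈ k (suc t) m (ℕ.≤∧≢⇒< t≤m t≢m) (subst (m <_) (ℕ.+-suc t k) m<t+k))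

interval-≥ : ∀ k t m → t + k ≤ m → total (interval k t) [_at m ] ≡ 0
interval-≥ zero t m _ = refl
interval-≥ (suc k) t m le = cong₂ _+_ (at-≢ (ℕ.<⇒≢ (ℕ.<-≤-trans (ℕ.m<m+n t z<s) le))) (interval-≥ k (suc t) m (subst (_≤ m) (ℕ.+-suc t k) le))

count-initialSites : ∀ p q s → count s (map +_ (initialSites p q 0)) ≡ total (interval p 1) (λ x → 1 when (+ x ℤ.≟ s)) + total (interval q p) (λ x → 1 when (+ x ℤ.≟ s))
count-initialSites p q s = trans (total-map +_ (initialSites p q 0) _) (trans (total-initialSites p q 0 _)
  (cong (λ t → total (interval p 1) _ + total (interval q t) (λ x → 1 when (+ x ℤ.≟ s))) (ℕ.+-identityʳ p)))

-- The intervals 1, ..., p and p, ..., n-1 cover the sites and overlap in p alone.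
requiredAt-count : ∀ p q → 1 ≤ p → 1 ≤ q → ∀ s → requiredAt (p + q) p s ≡ count s (map +_ (initialSites p q 0))
requiredAt-count p q 1≤p 1≤q -[1+ m ] = sym (trans (total-map +_ (initialSites p q 0) _)
  (total-zero (initialSites p q 0) _ (λ x → when-false (+ x ℤ.≟ -[1+ m ]) {1} λ ())))
requiredAt-count p q 1≤p 1≤q (+ m) = trans (split m) (sym (count-initialSites p q (+ m)))
  where
  inside : ∀ m → Dec (+ 1 ℤ.≤ + m × + m ℤ.≤ + (p + q ∸ 1))
  inside m = (+ 1 ℤ.≤? + m) ×-dec (+ m ℤ.≤? + (p + q ∸ 1))
  ≤-last : ∀ {m} → m < p + q → + m ℤ.≤ + (p + q ∸ 1)
  ≤-last m<n = ℤ.+≤+ (ℕ.<⇒≤pred m<n)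
  on : ∀ m → 1 ≤ m → m < p + q → requiredAt (p + q) p (+ m) ≡ (if does (+ m ℤ.≟ + p) then 2 else 1)
  on m 1≤m m<n = if-true (inside m) (ℤ.+≤+ 1≤m , ≤-last m<n)
  off : ∀ m → ¬ (+ 1 ℤ.≤ + m × + m ℤ.≤ + (p + q ∸ 1)) → requiredAt (p + q) p (+ m) ≡ 0
  off m out = if-false (inside m) out
  once : ∀ m → m ≢ p → (if does (+ m ℤ.≟ + p) then 2 else 1) ≡ 1
  once m m≢p = if-false (+ m ℤ.≟ + p) (m≢p ∘ ℤ.+-injective)
  split : ∀ m → requiredAt (p + q) p (+ m) ≡ total (interval p 1) [_at m ] + total (interval q p) [_at m ]
  split zero = trans (off 0 λ { (ℤ.+≤+ () , _) }) (sym (cong₂ _+_ (interval-< p 1 0 ℕ.≤-refl) (interval-< q p 0 1≤p)))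
  split m@(suc _) with ℕ.<-cmp m p
  ... | tri< m<p m≢p _ = trans (on m (s≤s z≤n) (ℕ.<-≤-trans m<p (ℕ.m≤m+n p q))) (trans (once m m≢p)
          (sym (cong₂ _+_ (interval-∈ p 1 m (s≤s z≤n) (ℕ.m<n⇒m<1+n m<p)) (interval-< q p m m<p))))
  ... | tri≈ _ refl _ = trans (on m (s≤s z≤n) (ℕ.m<m+n m 1≤q)) (trans (if-true (+ m ℤ.≟ + m) refl)
          (sym (cong₂ _+_ (interval-∈ p 1 m (s≤s z≤n) ℕ.≤-refl) (interval-∈ q p m ℕ.≤-refl (ℕ.m<m+n m 1≤q)))))
  ... | tri> _ m≢p p<m with m ℕ.<? p + q
  ...   | yes m<n = trans (on m (s≤s z≤n) m<n) (trans (once m m≢p)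
            (sym (cong₂ _+_ (interval-≥ p 1 m p<m) (interval-∈ q p m (ℕ.<⇒≤ p<m) m<n))))
  ...   | no m≮n = trans (off m (λ { (_ , ℤ.+≤+ m≤) → m≮n (subst (m <_) (ℕ.suc-pred (p + q) {{ℕ.>-nonZero (ℕ.<-≤-trans 1≤p (ℕ.m≤m+n p q))}}) (s≤s m≤)) }))
            (sym (cong₂ _+_ (interval-≥ p 1 m p<m) (interval-≥ q p m (ℕ.≮⇒≥ m≮n))))

InS⇒↭ : ∀ {p q} → 1 ≤ p → 1 ≤ q → (C : Config (p + q)) → InS (p + q) p C → toList C ↭ map +_ (initialSites p q 0)
InS⇒↭ {p} {q} 1≤p 1≤q C inS = count-↭ _ _ (λ s → trans (sym (chipsAt-count s C)) (trans (inS s) (requiredAt-count p q 1≤p 1≤q s)))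

↭⇒InS : ∀ {p q} → 1 ≤ p → 1 ≤ q → (C : Config (p + q)) → toList C ↭ map +_ (initialSites p q 0) → InS (p + q) p C
↭⇒InS {p} {q} 1≤p 1≤q C perm s = trans (chipsAt-count s C) (trans (total-↭ _ perm) (sym (requiredAt-count p q 1≤p 1≤q s)))

clamp : ℕ → ℤ → ℕ
clamp N (+ m) = m ⊓ N
clamp N -[1+ _ ] = 0

clamp-step : ∀ N s → clamp N s ≤ suc (clamp N (s ℤ.- + 1))
clamp-step N (+ zero) = z≤n
clamp-step N (+ suc m) = ℕ.⊓-monoʳ-≤ (suc m) (ℕ.n≤1+n N)
clamp-step N -[1+ m ] = z≤n

interval-⊑ : ∀ k t m → total (interval k t) (λ x → ⟦ + x ⊑ + m ⟧) ≡ k ⊓ (suc m ∸ t)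
interval-⊑ zero t m = refl
interval-⊑ (suc k) t m with t ℕ.≤? m
... | yes t≤m = trans (cong₂ _+_ (⊑-yes (ℤ.+≤+ t≤m)) (interval-⊑ k (suc t) m)) (sym (cong (suc k ⊓_) (ℕ.+-∸-assoc 1 t≤m)))
... | no t≰m = trans (cong₂ _+_ (⊑-no (ℤ.+<+ (ℕ.≰⇒> t≰m))) (trans (interval-⊑ k (suc t) m)
    (trans (cong (k ⊓_) (ℕ.m≤n⇒m∸n≡0 (ℕ.<⇒≤ (ℕ.≰⇒> t≰m)))) (ℕ.⊓-zeroʳ k)))) (sym (cong (suc k ⊓_) (ℕ.m≤n⇒m∸n≡0 (ℕ.≰⇒> t≰m))))

-- The cumulative count equals the number of sites before p and exceeds it by one from p on; p + q
-- is n - 1 here.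
initial-Inv : ∀ {p q m} → (C : Config m) → toList C ↭ map +_ (initialSites p (suc q) 0) →
  Confluence.Inv (clamp (p + q)) (clamp-step (p + q)) C
initial-Inv {p} {q} C perm -[1+ m ] = z≤n , ℕ.≤-trans (ℕ.≤-reflexive (trans (total-↭ _ perm)
  (trans (total-map +_ (initialSites p (suc q) 0) _) (total-zero (initialSites p (suc q) 0) _ (λ x → ⊑-no {+ x} { -[1+ m ]} ℤ.-<+))))) z≤n
initial-Inv {p} {q} C perm (+ m) = subst (λ b → m ⊓ (p + q) ≤ b × b ≤ suc (m ⊓ (p + q))) (sym below≡) bounds
  where
  below≡ : below (+ m) C ≡ p ⊓ m + suc q ⊓ (suc m ∸ p)
  below≡ = trans (total-↭ _ perm) (trans (total-map +_ (initialSites p (suc q) 0) _) (trans (total-initialSites p (suc q) 0 _)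
    (cong₂ _+_ (interval-⊑ p 1 m) (trans (interval-⊑ (suc q) (p + 0) m) (cong (λ x → suc q ⊓ (suc m ∸ x)) (ℕ.+-identityʳ p))))))
  bounds : m ⊓ (p + q) ≤ p ⊓ m + suc q ⊓ (suc m ∸ p) × p ⊓ m + suc q ⊓ (suc m ∸ p) ≤ suc (m ⊓ (p + q))
  bounds with p ℕ.≤? m
  ... | yes p≤m = subst (λ b → m ⊓ (p + q) ≤ b × b ≤ suc (m ⊓ (p + q))) (sym eq) (ℕ.n≤1+n _ , ℕ.≤-refl)
    where
    open ≡-Reasoning
    eq : p ⊓ m + suc q ⊓ (suc m ∸ p) ≡ suc (m ⊓ (p + q))
    eq = begin
      p ⊓ m + suc q ⊓ (suc m ∸ p) ≡⟨ cong (_+ suc q ⊓ (suc m ∸ p)) (ℕ.m≤n⇒m⊓n≡m p≤m) ⟩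
      p + suc q ⊓ (suc m ∸ p) ≡⟨ ℕ.+-distribˡ-⊓ p (suc q) (suc m ∸ p) ⟩
      (p + suc q) ⊓ (p + (suc m ∸ p)) ≡⟨ cong₂ _⊓_ (ℕ.+-suc p q) (ℕ.m+[n∸m]≡n (ℕ.m≤n⇒m≤1+n p≤m)) ⟩
      suc ((p + q) ⊓ m) ≡⟨ cong suc (ℕ.⊓-comm (p + q) m) ⟩
      suc (m ⊓ (p + q)) ∎
  ... | no p≰m = subst (λ b → m ⊓ (p + q) ≤ b × b ≤ suc (m ⊓ (p + q))) (sym eq) (ℕ.≤-refl , ℕ.n≤1+n _)
    where
    open ≡-Reasoning
    m<p = ℕ.≰⇒> p≰m
    eq : p ⊓ m + suc q ⊓ (suc m ∸ p) ≡ m ⊓ (p + q)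
    eq = begin
      p ⊓ m + suc q ⊓ (suc m ∸ p) ≡⟨ cong₂ _+_ (ℕ.m≥n⇒m⊓n≡n (ℕ.<⇒≤ m<p)) (cong (suc q ⊓_) (ℕ.m≤n⇒m∸n≡0 m<p)) ⟩
      m + 0 ≡⟨ ℕ.+-identityʳ m ⟩
      m ≡⟨ ℕ.m≤n⇒m⊓n≡m (ℕ.≤-trans (ℕ.<⇒≤ m<p) (ℕ.m≤m+n p q)) ⟨
      m ⊓ (p + q) ∎

module _ {n : ℕ} where
  sites-number : ∀ (ks : List (Fin n)) t → sites (number ks t) ≡ interval (length ks) t
  sites-number [] t = refl
  sites-number (k ∷ ks) t = cong (t ∷_) (sites-number ks (suc t))

  sites-layout : ∀ (zs xs : List (Fin n)) t → sites (layout zs xs t) ≡ initialSites (length zs) (length xs) t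
  sites-layout [] xs t = sites-number xs t
  sites-layout (z ∷ zs) xs t = cong (suc t ∷_) (sites-layout zs xs (suc t))

  toList-lookup : ∀ {m} {X : Set} (C : Vec X m) → map (lookup C) (allFin m) ≡ toList C
  toList-lookup [] = refl
  toList-lookup (x ∷ C) = cong (x ∷_) (trans (List.map-tabulate Fin.suc (lookup (x ∷ C))) (trans (sym (List.map-tabulate id (lookup C))) (toList-lookup C)))

  At-layout⇒↭ : ∀ {C : Config n} {zs xs} → zs ++ xs ↭ allFin n → At C (layout zs xs 0) → toList C ↭ map +_ (initialSites (length zs) (length xs) 0)
  At-layout⇒↭ {C} {zs} {xs} p at = ↭-trans (↭-reflexive (sym (toList-lookup C))) (↭-trans (↭.map⁺ (lookup C) (↭-sym p))
    (↭-reflexive (trans (cong (map (lookup C)) (sym (chips-layout zs xs 0))) (trans (At-map {C = C} (layout zs xs 0) at) (cong (λ ss → map +_ ss) (sites-layout zs xs 0))))))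

  ↭⇒At-layout : ∀ {C : Config n} p q → toList C ↭ map +_ (initialSites p q 0) → n ≡ p + q → ∃[ zs ] ∃[ xs ]
    (length zs ≡ p × length xs ≡ q × zs ++ xs ↭ allFin n × At C (layout zs xs 0))
  ↭⇒At-layout {C} p q perm refl with ↭-map-inv (lookup C) (subst (_↭ _) (sym (toList-lookup C)) perm)
  ... | u , eq , u↭ = take p u , drop p u , lz , lx , subst (_↭ allFin n) (sym u≡) (↭-sym u↭) ,
      map-At {C = C} (layout (take p u) (drop p u) 0) (begin
        map (lookup C) (chips (layout (take p u) (drop p u) 0)) ≡⟨ cong (map (lookup C)) (trans (chips-layout (take p u) (drop p u) 0) u≡) ⟩
        map (lookup C) u ≡⟨ eq ⟨
        map +_ (initialSites p q 0) ≡⟨ cong₂ (λ a b → map +_ (initialSites a b 0)) lz lx ⟨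
        map +_ (initialSites (length (take p u)) (length (drop p u)) 0) ≡⟨ cong (λ ss → map +_ ss) (sites-layout (take p u) (drop p u) 0) ⟨
        map +_ (sites (layout (take p u) (drop p u) 0)) ∎)
    where
    open ≡-Reasoning
    u≡ = List.take++drop≡id p u
    len : length u ≡ p + q
    len = trans (sym (↭-length u↭)) (List.length-tabulate id)
    lz : length (take p u) ≡ p
    lz = trans (List.length-take p u) (trans (cong (p ⊓_) len) (ℕ.m≤n⇒m⊓n≡m (ℕ.m≤m+n p q)))
    lx : length (drop p u) ≡ q
    lx = trans (List.length-drop p u) (trans (cong (_∸ p) len) (ℕ.m+n∸m≡n p q))

-- Configurations toppling to π correspond to preimages.

++-injective : ∀ {X : Set} (as cs : List X) {bs ds} → length as ≡ length cs → as ++ bs ≡ cs ++ ds → as ≡ cs × bs ≡ ds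
++-injective [] [] _ eq = refl , eq
++-injective (a ∷ as) (c ∷ cs) len eq with List.∷-injective eq
... | refl , eq′ = map₁ (cong (a ∷_)) (++-injective as cs (ℕ.suc-injective len) eq′)

map-unique : ∀ {X Y : Set} (f : X → Y) {xs} → (∀ {x y} → x ∈ xs → y ∈ xs → f x ≡ f y → x ≡ y) → Unique xs → Unique (map f xs)
map-unique f inj [] = []
map-unique f {x ∷ xs} inj (x∉ ∷ u) =
  All.tabulate (λ fy∈ e → let (y , y∈ , e′) = ∈-map⁻ f fy∈ in All.lookup x∉ y∈ (inj (here refl) (there y∈) (trans e e′)))
  ∷ map-unique f (λ x∈ y∈ → inj (there x∈) (there y∈)) u

length-run₂ : ∀ {n} (zs xs : List (Fin n)) → length (proj₂ (run zs xs)) ≡ length zs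
length-run₂ [] xs = refl
length-run₂ (z ∷ zs) xs = cong suc (length-run₂ zs xs)

configuration : ∀ {n} → List (Fin n) × List (Fin n) → Config n
configuration (zs , xs) = place (layout zs xs 0)

module _ {n p q : ℕ} (n≡ : n ≡ p + suc q) (1≤p : 1 ≤ p) (π : Perm n) (perm : IsPerm π) where
  private
    vs R : List (Fin n)
    vs = take (suc q) (toList π)
    R = drop (suc q) (toList π)

    vs++R : vs ++ R ≡ toList π
    vs++R = List.take++drop≡id (suc q) (toList π)

    length-π : length (toList π) ≡ p + suc q
    length-π = trans (Vec.length-toList π) n≡

    length-R : length R ≡ p
    length-R = trans (List.length-drop (suc q) (toList π)) (trans (cong (_∸ suc q) length-π) (ℕ.m+n∸n≡m p (suc q)))

    length-vs : length vs ≡ suc q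
    length-vs = trans (List.length-take (suc q) (toList π)) (trans (cong (suc q ⊓_) length-π) (ℕ.m≤n⇒m⊓n≡m (ℕ.m≤n+m (suc q) p)))

  settle : ∀ {C : Config n} {zs xs} → zs ++ xs ↭ allFin n → At C (layout zs xs 0) → let (ws , S) = run zs xs in
    ∃[ D ] (Star Topple C D × Stable D × AllPairs (λ k l → lookup D k ℤ.< lookup D l) (ws ++ S))
  settle {C} {zs} {xs} p at with simulate* {C = C} (run-steps zs xs 0) at
      (subst Unique (sym (chips-layout zs xs 0)) (Unique-resp-↭ (↭-sym p) (Unique.allFin⁺ n)))
  ... | D , ts , at′ = D , ts , sorted⇒Stable {D = D} (↭-trans (run-↭ zs xs) p) sorted , sorted
    where sorted = gapped-sorted {C = D} (proj₁ (run zs xs)) (proj₂ (run zs xs)) 0 at′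

  -- The sweeps reach a stable configuration, confluence identifies it with the given one, and both
  -- words list its chips by site.
  TopplesTo⇒run : ∀ {C : Config n} {zs xs} → length zs ≡ p → length xs ≡ suc q → zs ++ xs ↭ allFin n → At C (layout zs xs 0) →
    TopplesTo C π → run zs xs ≡ (vs , R)
  TopplesTo⇒run {C} {zs} {xs} lz lx perm′ at (D , ts , stable , reads) with settle {C} {zs} {xs} perm′ at
  ... | D′ , ts′ , stable′ , sorted with Confluence.final-unique (clamp (p + q)) (clamp-step (p + q))
        (initial-Inv {p} {q} C (subst₂ (λ a b → toList C ↭ map +_ (initialSites a b 0)) lz lx (At-layout⇒↭ {C = C} {zs} {xs} perm′ at))) ts stable ts′ stable′
  ... | refl = let (e₁ , e₂) = ++-injective (proj₁ (run zs xs)) vs len word≡ in cong₂ _,_ e₁ e₂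
    where
    word≡ : proj₁ (run zs xs) ++ proj₂ (run zs xs) ≡ vs ++ R
    word≡ = trans (sorted-unique ℤ.<-asym sorted (ReadsAs⇒AllPairs {D = D} {π} reads)
      (↭-trans (run-↭ zs xs) (↭-trans perm′ (↭-sym (IsPerm⇒↭ {π = π} perm))))) (sym vs++R)
    len : length (proj₁ (run zs xs)) ≡ length vs
    len = ℕ.+-cancelʳ-≡ p _ _ (begin
      length (proj₁ (run zs xs)) + p ≡⟨ cong (λ l → length (proj₁ (run zs xs)) + l) (trans (length-run₂ zs xs) lz) ⟨
      length (proj₁ (run zs xs)) + length (proj₂ (run zs xs)) ≡⟨ List.length-++ (proj₁ (run zs xs)) ⟨
      length (proj₁ (run zs xs) ++ proj₂ (run zs xs)) ≡⟨ cong length word≡ ⟩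
      length (vs ++ R) ≡⟨ List.length-++ vs ⟩
      length vs + length R ≡⟨ cong (λ l → length vs + l) length-R ⟩
      length vs + p ∎)
      where open ≡-Reasoning

  preimages-shape : ∀ {zs xs} → (zs , xs) ∈ preimages R vs →
    Ascending zs xs × run zs xs ≡ (vs , R) × length zs ≡ p × length xs ≡ suc q × zs ++ xs ↭ allFin n
  preimages-shape {zs} {xs} z∈ with preimages⁻ R vs z∈
  ... | asc , eq = asc , eq , lz , lx , perm′
    where
    perm′ : zs ++ xs ↭ allFin n
    perm′ = ↭-trans (↭-sym (run-↭ zs xs)) (↭-trans (↭-reflexive (trans (cong (λ s → proj₁ s ++ proj₂ s) eq) vs++R)) (IsPerm⇒↭ {π = π} perm))
    lz : length zs ≡ p
    lz = trans (sym (length-run₂ zs xs)) (trans (cong (length ∘ proj₂) eq) length-R)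
    lx : length xs ≡ suc q
    lx = ℕ.+-cancelˡ-≡ p _ _ (trans (cong (_+ length xs) (sym lz)) (trans (sym (List.length-++ zs))
      (trans (↭-length perm′) (trans (List.length-tabulate id) n≡))))

  At-configuration : ∀ {zs xs} → zs ++ xs ↭ allFin n → At (configuration (zs , xs)) (layout zs xs 0)
  At-configuration {zs} {xs} perm′ = At-place (layout zs xs 0)
    (subst Unique (sym (chips-layout zs xs 0)) (Unique-resp-↭ (↭-sym perm′) (Unique.allFin⁺ n)))

  ∈⇒topples : ∀ {C} → C ∈ map configuration (preimages R vs) → InS n p C × TopplesTo C π
  ∈⇒topples {C} C∈ with ∈-map⁻ configuration C∈
  ... | (zs , xs) , z∈ , refl with preimages-shape z∈
  ... | asc , eq , lz , lx , perm′ with settle {C} {zs} {xs} perm′ (At-configuration {zs} {xs} perm′)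
  ... | D , ts , stable , sorted = inS n≡ , D , ts , stable ,
        AllPairs⇒ReadsAs {D = D} {π} (subst (AllPairs _) (trans (cong (λ s → proj₁ s ++ proj₂ s) eq) vs++R) sorted)
    where
    inS : n ≡ p + suc q → InS n p C
    inS refl = ↭⇒InS 1≤p (s≤s z≤n) C (subst₂ (λ a b → toList C ↭ map +_ (initialSites a b 0)) lz lx (At-layout⇒↭ {C = C} {zs} {xs} perm′ (At-configuration {zs} {xs} perm′)))

  topples⇒∈ : ∀ {C} → InS n p C × TopplesTo C π → C ∈ map configuration (preimages R vs)
  topples⇒∈ {C} (inS , topples) with ↭⇒At-layout {C = C} p (suc q) (sites↭ n≡ inS) n≡
    where
    sites↭ : n ≡ p + suc q → InS n p C → toList C ↭ map +_ (initialSites p (suc q) 0)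
    sites↭ refl inS = InS⇒↭ 1≤p (s≤s z≤n) C inS
  ... | [] , xs , refl , lx , perm′ , at = ⊥-elim (ℕ.<-irrefl refl 1≤p)
  -- The two chips on site p may be listed in the wrong order; `ascend` swaps them if so, without
  -- changing the configuration.
  ... | z ∷ zs , x ∷ xs , lz , lx , perm′ , at with ascend {C = C} z zs x xs 0 (Unique-resp-↭ (↭-sym perm′) (Unique.allFin⁺ n)) at
  ... | zs′ , xs′ , asc , len , perm″ , at′ = subst (_∈ map configuration (preimages R vs)) (sym C≡)
        (∈-map⁺ configuration (subst (λ s → (zs′ , xs′) ∈ preimages (proj₂ s) (proj₁ s)) runs
          (preimages⁺ zs′ xs′ (Unique-resp-↭ (↭-sym perm‴) (Unique.allFin⁺ n)) asc)))
    where
    perm‴ : zs′ ++ xs′ ↭ allFin n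
    perm‴ = ↭-trans perm″ perm′
    lz′ : length zs′ ≡ p
    lz′ = trans len lz
    lx′ : length xs′ ≡ suc q
    lx′ = ℕ.+-cancelˡ-≡ p _ _ (trans (cong (_+ length xs′) (sym lz′)) (trans (sym (List.length-++ zs′))
      (trans (↭-length perm‴) (trans (List.length-tabulate id) n≡))))
    runs : run zs′ xs′ ≡ (vs , R)
    runs = TopplesTo⇒run {C} {zs′} {xs′} lz′ lx′ perm‴ at′ topples
    C≡ : C ≡ configuration (zs′ , xs′)
    C≡ = At-unique {C = C} at′ (At-configuration {zs′} {xs′} perm‴) (subst (_↭ allFin n) (sym (chips-layout zs′ xs′ 0)) perm‴)

  configurations-unique : Unique (map configuration (preimages R vs))
  configurations-unique = map-unique configuration inj (preimages-unique R vs)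
    where
    inj : ∀ {x y} → x ∈ preimages R vs → y ∈ preimages R vs → configuration x ≡ configuration y → x ≡ y
    inj {zs , xs} {zs′ , xs′} x∈ y∈ eq with preimages-shape x∈ | preimages-shape y∈
    ... | asc , _ , lz , _ , perm′ | asc′ , _ , lz′ , _ , perm″ =
      let (e₁ , e₂) = ++-injective zs zs′ (trans lz (sym lz′)) (layout-unique {C = configuration (zs , xs)} asc asc′
            (At-configuration {zs} {xs} perm′) (subst (λ C → At C (layout zs′ xs′ 0)) (sym eq) (At-configuration {zs′} {xs′} perm″))
            (↭-trans perm′ (↭-sym perm″)))
      in cong₂ _,_ e₁ e₂

  -- One member of the list is needed: its existence shows that all left entries lie below all right
  -- entries.
  count-configurations : ∀ {C} → C ∈ map configuration (preimages R vs) →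
    + length (map configuration (preimages R vs)) / 1 ≡ ½ * polyBernoulliB (maxima vs) (minima R)
  count-configurations C∈ with ∈-map⁻ configuration C∈
  ... | _ , z∈ , _ = begin
    ι (length (map configuration (preimages R vs))) ≡⟨ cong ι (List.length-map configuration (preimages R vs)) ⟩
    ι N ≡⟨ ½-double N ⟩
    ½ * ι (N + N) ≡⟨ cong (λ k → ½ * ι k) (doubled R vs (subst (0 <_) (sym length-R) 1≤p) (subst (0 <_) (sym length-vs) z<s) (preimages-below R vs z∈)) ⟩
    ½ * ι (polyBernoulliℕ (minima R) (maxima vs)) ≡⟨ cong (½ *_) (polyBernoulliℕ-correct (minima R) (maxima vs)) ⟩
    ½ * polyBernoulliB (maxima vs) (minima R) ∎
    where
    open ≡-Reasoning
    N = length (preimages R vs)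
    doubled : ∀ (R vs : List (Fin n)) → 0 < length R → 0 < length vs → Below vs R →
      length (preimages R vs) + length (preimages R vs) ≡ polyBernoulliℕ (minima R) (maxima vs)
    doubled (h ∷ R) (o ∷ os) _ _ = preimages-count h R o os

theorem2p12 : (n p : ℕ) → 2 ≤ n → 1 ≤ p → p ≤ n ∸ 1 →
    (π : Perm n) → IsPerm π → Resultant n p π →
    (i j : ℕ) → lrMaxima (πleft p π) ≡ i → rlMinima (πright p π) ≡ j →
    ∃[ L ] (Unique L × (∀ (C : Config n) → (C ∈ L ⇔ (InS n p C × TopplesTo C π)))
    × (+ (length L) / 1 ≡ ½ * polyBernoulliB i j))
theorem2p12 n@(suc _) p 2≤n 1≤p p≤n-1 π perm (C , C-topples) _ _ refl refl =
  map configuration (preimages (drop (suc q) (toList π)) (take (suc q) (toList π))) ,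
  configurations-unique n≡ 1≤p π perm ,
  (λ C → mk⇔ (∈⇒topples n≡ 1≤p π perm) (topples⇒∈ n≡ 1≤p π perm)) ,
  trans (count-configurations n≡ 1≤p π perm (topples⇒∈ n≡ 1≤p π perm C-topples)) (cong₂ (λ i j → ½ * polyBernoulliB i j)
    (cong lrMaxima (trans (sym (List.take-map (suc q) (toList π))) (cong (λ k → take k (word π)) (sym n∸p))))
    (cong rlMinima (trans (sym (List.drop-map (suc q) (toList π))) (cong (λ k → drop k (word π)) (sym n∸p)))))
  where
  -- Taken so that n - p is `suc q`, which shows that the left part is non-empty.
  q = n ∸ suc p
  n∸p : n ∸ p ≡ suc q
  n∸p = ℕ.+-∸-assoc 1 p≤n-1
  n≡ : n ≡ p + suc q
  n≡ = trans (sym (ℕ.m+[n∸m]≡n (ℕ.m≤n⇒m≤1+n p≤n-1))) (cong (λ k → p + k) n∸p)
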